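{- As formal power series in $q$, \begin{align*} \sum_{m,n\ge0}\frac{q^{\frac{m(3m+1)}{2}+4mn+4n^2}(1+q^{2m+4n+1})}{(q;q)_m(q^2;q^2)_n} =\sum_{j\ge0}\frac{q^j}{(q^{10};q^{10})_{\lfloor j/2\rfloor}}\sum_{i=0}^{\lfloor j/2\rfloor}{\lfloor j/2\rfloor\brack i}_{q^{10}}\frac{(-q^3;q^{10})_{i+\lceil j/2\rceil-\lfloor j/2\rfloor}(-q^8;q^{10})_i}{(q^5;q^{10})_{i+\lceil j/2\rceil-\lfloor j/2\rfloor}}(q^6)^{\lfloor j/2\rfloor-i}, \end{align*} \begin{align*} \sum_{m,n\ge0}\frac{q^{\frac{m(3m+1)}{2}+4mn+4n^2+m+2n}(1+q^{2m+4n+2})}{(q;q)_m(q^2;q^2)_n} =\sum_{j\ge0}\frac{q^{2j}}{(q^{10};q^{10})_{\lfloor j/2\rfloor}}\sum_{i=0}^{\lfloor j/2\rfloor}{\lfloor j/2\rfloor\brack i}_{q^{10}}\frac{(-q;q^{10})_{i+\lceil j/2\rceil-\lfloor j/2\rfloor}(-q^6;q^{10})_i}{(q^5;q^{10})_{i+\lceil j/2\rceil-\lfloor j/2\rfloor}}(q^2)^{\lfloor j/2\rfloor-i}. \end{align*}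
   Context: $(a;p)_k=\prod_{i=0}^{k-1}(1-ap^i)$. For integers $0\le B\le A$, ${A\brack B}_p=\frac{(p;p)_A}{(p;p)_B(p;p)_{A-B}}$. $\lfloor\cdot\rfloor,\lceil\cdot\rceil$ are floor and ceiling. -}

module Defs where

open import Data.Nat using (ℕ; zero; suc; _∸_)
open import Data.Integer using (ℤ; +_; -_; _+_; _*_)

-- Formal power series in q with integer coefficients: f N = coefficient of q^N.
PS : Set
PS = ℕ → ℤ

sumℤ : ℕ → (ℕ → ℤ) → ℤ
sumℤ zero f = f 0
sumℤ (suc n) f = sumℤ n f + f (suc n)

0ₚ : PS
0ₚ _ = + 0

1ₚ : PS
1ₚ zero = + 1
1ₚ (suc _) = + 0

q : PS
q 1 = + 1
q _ = + 0

infixl 6 _+ₚ_ _-ₚ_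
infixl 7 _*ₚ_
infixr 8 _^ₚ_

_+ₚ_ : PS → PS → PS
(f +ₚ g) n = f n + g n

negₚ : PS → PS
negₚ f n = - f n

_-ₚ_ : PS → PS → PS
f -ₚ g = f +ₚ negₚ g

_*ₚ_ : PS → PS → PS
(f *ₚ g) n = sumℤ n (λ k → f k * g (n ∸ k))

_^ₚ_ : PS → ℕ → PS
f ^ₚ zero = 1ₚ
f ^ₚ suc k = f ^ₚ k *ₚ f

Σₚ : ℕ → (ℕ → PS) → PS
Σₚ n f N = sumℤ n (λ k → f k N)

-- Multiplicative inverse of a series f with constant term 1:
-- 1/f = 1/(1-(1-f)) = Σ_{k≥0} (1-f)^k ; since (1-f)^k has order ≥ k,
-- the coefficient of q^N only involves k ≤ N.
inv : PS → PS
inv f N = sumℤ N (λ k → ((1ₚ -ₚ f) ^ₚ k) N)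

-- Infinite sum Σ_{k≥0} f k of a family with ord(f k) ≥ k (so coefficient N only
-- involves k ≤ N).  All families used in the statement satisfy this.
Σ∞ : (ℕ → PS) → PS
Σ∞ f N = sumℤ N (λ k → f k N)

-- Double infinite sum Σ_{m,n≥0} f m n of a family with ord(f m n) ≥ max(m,n).
Σ∞₂ : (ℕ → ℕ → PS) → PS
Σ∞₂ f N = sumℤ N (λ m → sumℤ N (λ n → f m n N))

poch : PS → PS → ℕ → PS
poch a p zero = 1ₚ
poch a p (suc k) = poch a p k *ₚ (1ₚ -ₚ a *ₚ p ^ₚ k)

-- Gaussian binomial [A ; B]_p = (p;p)_A / ((p;p)_B (p;p)_{A-B})   (used with B ≤ A)
qbin : PS → ℕ → ℕ → PS
qbin p A B = poch p p A *ₚ inv (poch p p B) *ₚ inv (poch p p (A ∸ B))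

module Submission where

-- Everything is done modulo q^M, that is, in a commutative ring with an element q such that q^M = 0: infinite
-- sums and products become finite, and every element congruent to 1 modulo q can be cancelled.
--
-- Left-hand sides.  Inserting q^(k(m+2n)), and 1 + q^(2m+4n+k+1) for the last factor of the numerator, gives a
-- family H_k with H_k = H_(k+1) + q^(k+1) H_(k+2) and H_k → 1; the left-hand sides are H_0 and H_1.  Rogers'
-- series θ_k satisfy the same recurrence and tend to (q;q)_∞, so (q;q)_∞ H_k = θ_k.  The Jacobi triple product
-- evaluates θ_0 and θ_1, whence H_0 = 1/((q;q^5)_∞ (q^4;q^5)_∞) and H_1 = 1/((q^2;q^5)_∞ (q^3;q^5)_∞).
--
-- Right-hand sides.  Put p = q^5.  The even and the odd j together merge the factors of base p^2 into factors of
-- base p, so that the sum is the product of Σ (-c;p)_n z^n / (p;p)_n and Σ (z^2 c^2)^l / (p^2;p^2)_l, with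
-- (z, c) = (q, q^3) or (q^2, q).  By the q-binomial theorem it is
-- (-zc;p)_∞ / ((z;p)_∞ (z^2 c^2;p^2)_∞) = 1 / ((z;p)_∞ (zc;p)_∞).

-- The coefficient of q^N is read modulo q^(N+1), where the geometric series behind `inv` can be cut
-- at one bound for all coefficients. In the abstract argument a reciprocal is only a sequence `v`
-- with `v k * poch p p k ≈ 1#`, so nothing depends on how it is computed.
--
-- The numerator factor 1 + q^(2m+4n+k+1) has a structural origin. Let D_k be the double sum without
-- it and S the shift k → k+1. Cancelling denominators gives D_k = D_(k+1) + q^(k+2) D_(k+3) +
-- q^(2k+4) D_(k+4), and the operator of this recurrence factors as (1 - S - q^(k+1) S^2)(1 +
-- q^(k+1) S^2). The second factor applied to D is H, which is why H obeys the short recurrence.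
--
-- On the right, the bases q^8 and q^6 (respectively q^6 and q^2) are c p and c^2. The first makes
-- (-c;p^2) and (-cp;p^2) interleave to (-c;p), just as (p;p^2) and (p^2;p^2) interleave to (p;p).
-- The second turns the leftover powers of z into powers of the square (zc)^2.

open import Algebra.Bundles using (CommutativeRing)
import Algebra.Properties.CommutativeSemigroup.Divisibility as CommutativeSemigroupDivisibility
open import Algebra.Solver.Ring.AlmostCommutativeRing using (_-Raw-AlmostCommutative⟶_; fromCommutativeRing)
open import Data.Integer.Base as ℤ using (ℤ; +_; -[1+_]; _⊖_)
import Data.Integer.Properties as ℤ
open import Data.Integer.Solver using (module +-*-Solver)
open import Data.Maybe.Base using (Maybe; just; nothing)
open import Data.Nat.Base as ℕ using (ℕ; zero; suc; _∸_; _≤_; _<_; s≤s; z≤n; ⌊_/2⌋; ⌈_/2⌉)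
import Data.Nat.Properties as ℕ
open import Data.Nat.Tactic.RingSolver using (solve-∀)
open import Data.Product.Base using (_,_; proj₁)
open import Data.Sum.Base using (inj₁; inj₂)
open import Function.Base using (_∘_)
open import Relation.Binary.PropositionalEquality as ≡ using (_≡_; _≗_)
open import Relation.Nullary.Decidable using (yes; no)

-- Ring normalisation with integer coefficients over an arbitrary commutative ring.

module IntegerSolver {c ℓ} (R : CommutativeRing c ℓ) where

  open CommutativeRing R
  open import Algebra.Properties.Ring ring
  open import Algebra.Properties.AbelianGroup +-abelianGroup using (⁻¹-∙-comm)
  open import Algebra.Properties.Semiring.Mult.TCOptimised semiring
  open import Relation.Binary.Reasoning.Setoid setoid

  fromℤ : ℤ → Carrier
  fromℤ (+ n)    = n × 1#
  fromℤ -[1+ n ] = - (suc n × 1#)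

  fromℤ-⊖ : ∀ m n → fromℤ (m ⊖ n) ≈ m × 1# - n × 1#
  fromℤ-⊖ m       zero    = sym (trans (+-congˡ -0#≈0#) (+-identityʳ _))
  fromℤ-⊖ zero    (suc n) = sym (+-identityˡ _)
  fromℤ-⊖ (suc m) (suc n) = begin
    fromℤ (suc m ⊖ suc n)                    ≡⟨ ≡.cong fromℤ (ℤ.[1+m]⊖[1+n]≡m⊖n m n) ⟩
    fromℤ (m ⊖ n)                            ≈⟨ fromℤ-⊖ m n ⟩
    m × 1# - n × 1#                          ≈⟨ +-congʳ (+-identityʳ _) ⟨
    m × 1# + 0# - n × 1#                     ≈⟨ +-congʳ (+-congˡ (-‿inverseʳ 1#)) ⟨
    m × 1# + (1# - 1#) - n × 1#              ≈⟨ +-congʳ (+-assoc _ _ _) ⟨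
    m × 1# + 1# - 1# - n × 1#                ≈⟨ +-assoc _ _ _ ⟩
    m × 1# + 1# + (- 1# - n × 1#)            ≈⟨ +-cong (+-comm _ _) (⁻¹-∙-comm _ _) ⟩
    1# + m × 1# - (1# + n × 1#)              ≈⟨ +-cong (1+× m 1#) (-‿cong (1+× n 1#)) ⟨
    suc m × 1# - suc n × 1#                  ∎

  fromℤ-+ : ∀ i j → fromℤ (i ℤ.+ j) ≈ fromℤ i + fromℤ j
  fromℤ-+ (+ m)    (+ n)    = ×-homo-+ 1# m n
  fromℤ-+ (+ m)    -[1+ n ] = fromℤ-⊖ m (suc n)
  fromℤ-+ -[1+ m ] (+ n)    = trans (fromℤ-⊖ n (suc m)) (+-comm _ _)
  fromℤ-+ -[1+ m ] -[1+ n ] = trans (-‿cong (trans (reflexive (≡.cong (_× 1#) lem)) (×-homo-+ 1# (suc m) (suc n))))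
                                    (sym (⁻¹-∙-comm _ _))
    where
    lem : suc (suc (m ℕ.+ n)) ≡ suc m ℕ.+ suc n
    lem = ≡.cong suc (≡.sym (ℕ.+-suc m n))

  fromℤ-neg : ∀ i → fromℤ (ℤ.- i) ≈ - fromℤ i
  fromℤ-neg (+ zero)   = sym -0#≈0#
  fromℤ-neg (+ suc n)  = refl
  fromℤ-neg -[1+ n ]   = sym (-‿involutive _)

  fromℤ-* : ∀ i j → fromℤ (i ℤ.* j) ≈ fromℤ i * fromℤ j
  fromℤ-* (+ m)    (+ n)    = trans (reflexive (≡.cong fromℤ (≡.sym (ℤ.pos-* m n)))) (×1-homo-* m n)
  fromℤ-* (+ m)    -[1+ n ] = begin
    fromℤ (+ m ℤ.* -[1+ n ])      ≡⟨ ≡.cong fromℤ (≡.sym (ℤ.neg-distribʳ-* (+ m) (+ suc n))) ⟩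
    fromℤ (ℤ.- (+ m ℤ.* + suc n)) ≈⟨ fromℤ-neg (+ m ℤ.* + suc n) ⟩
    - fromℤ (+ m ℤ.* + suc n)     ≈⟨ -‿cong (fromℤ-* (+ m) (+ suc n)) ⟩
    - (m × 1# * suc n × 1#)       ≈⟨ -‿distribʳ-* _ _ ⟩
    m × 1# * - (suc n × 1#)       ∎
  fromℤ-* -[1+ m ] (+ n) = begin
    fromℤ (-[1+ m ] ℤ.* + n)      ≡⟨ ≡.cong fromℤ (≡.sym (ℤ.neg-distribˡ-* (+ suc m) (+ n))) ⟩
    fromℤ (ℤ.- (+ suc m ℤ.* + n)) ≈⟨ fromℤ-neg (+ suc m ℤ.* + n) ⟩
    - fromℤ (+ suc m ℤ.* + n)     ≈⟨ -‿cong (fromℤ-* (+ suc m) (+ n)) ⟩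
    - (suc m × 1# * n × 1#)       ≈⟨ -‿distribˡ-* _ _ ⟩
    - (suc m × 1#) * n × 1#       ∎
  fromℤ-* -[1+ m ] -[1+ n ] = begin
    (suc m ℕ.* suc n) × 1#              ≈⟨ ×1-homo-* (suc m) (suc n) ⟩
    suc m × 1# * suc n × 1#             ≈⟨ -‿involutive _ ⟨
    - - (suc m × 1# * suc n × 1#)       ≈⟨ -‿cong (-‿distribʳ-* _ _) ⟩
    - (suc m × 1# * - (suc n × 1#))     ≈⟨ -‿distribˡ-* _ _ ⟩
    - (suc m × 1#) * - (suc n × 1#)     ∎

  ℤ⟶R : ℤ.+-*-rawRing -Raw-AlmostCommutative⟶ fromCommutativeRing R
  ℤ⟶R = record
    { ⟦_⟧ = fromℤ ; +-homo = fromℤ-+ ; *-homo = fromℤ-* ; -‿homo = fromℤ-neg ; 0-homo = refl ; 1-homo = refl }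

  -- Only a partial test, since distinct integers may have equal images in `R`.
  fromℤ≟ : ∀ i j → Maybe (fromℤ i ≈ fromℤ j)
  fromℤ≟ i j with i ℤ.≟ j
  ... | yes i≡j = just (reflexive (≡.cong fromℤ i≡j))
  ... | no  _   = nothing

  open import Algebra.Solver.Ring ℤ.+-*-rawRing (fromCommutativeRing R) ℤ⟶R fromℤ≟ public
    using (solve; _:=_; _:+_; _:*_; _:-_; :-_; con; _:^_)

-- Finite sums: shifts, reversal, pairing, and the Cauchy product.

module FiniteSums {c ℓ} (R : CommutativeRing c ℓ) where

  open CommutativeRing R
  open IntegerSolver R
  open import Relation.Binary.Reasoning.Setoid setoid

  Σ< : ℕ → (ℕ → Carrier) → Carrier
  Σ< zero    f = 0#
  Σ< (suc n) f = Σ< n f + f n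

  Σ-cong< : ∀ {f g} n → (∀ k → k < n → f k ≈ g k) → Σ< n f ≈ Σ< n g
  Σ-cong< zero    f≈g = refl
  Σ-cong< (suc n) f≈g = +-cong (Σ-cong< n λ k k<n → f≈g k (ℕ.m<n⇒m<1+n k<n)) (f≈g n ℕ.≤-refl)

  Σ-cong : ∀ {f g} n → (∀ k → f k ≈ g k) → Σ< n f ≈ Σ< n g
  Σ-cong n f≈g = Σ-cong< n λ k _ → f≈g k

  Σ-zero : ∀ {f} n → (∀ k → f k ≈ 0#) → Σ< n f ≈ 0#
  Σ-zero zero    f≈0 = refl
  Σ-zero (suc n) f≈0 = trans (+-cong (Σ-zero n f≈0) (f≈0 n)) (+-identityʳ 0#)

  Σ-+ : ∀ {f g} n → Σ< n (λ k → f k + g k) ≈ Σ< n f + Σ< n g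
  Σ-+ zero    = sym (+-identityʳ 0#)
  Σ-+ (suc n) = trans (+-congʳ (Σ-+ n))
    (solve 4 (λ a b c d → a :+ b :+ (c :+ d) := a :+ c :+ (b :+ d)) refl _ _ _ _)

  Σ-*ˡ : ∀ {f} a n → a * Σ< n f ≈ Σ< n (λ k → a * f k)
  Σ-*ˡ a zero    = zeroʳ a
  Σ-*ˡ a (suc n) = trans (distribˡ a _ _) (+-congʳ (Σ-*ˡ a n))

  Σ-*ʳ : ∀ {f} a n → Σ< n f * a ≈ Σ< n (λ k → f k * a)
  Σ-*ʳ a n = trans (*-comm _ a) (trans (Σ-*ˡ a n) (Σ-cong n λ k → *-comm a _))

  Σ-- : ∀ {f g} n → Σ< n f - Σ< n g ≈ Σ< n (λ k → f k - g k)
  Σ-- zero    = -‿inverseʳ 0#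
  Σ-- (suc n) = trans (solve 4 (λ a b c d → a :+ b :- (c :+ d) := a :- c :+ (b :- d)) refl _ _ _ _)
    (+-congʳ (Σ-- n))

  Σ-head : ∀ {f} n → Σ< (suc n) f ≈ f 0 + Σ< n (f ∘ suc)
  Σ-head zero    = +-comm 0# _
  Σ-head (suc n) = trans (+-congʳ (Σ-head n)) (+-assoc _ _ _)

  -- The shift behind every recurrence below: a factor such as 1 - p^m kills the term at 0, and
  -- nilpotency of q kills the term at n, so the range stays the same.
  Σ-shift : ∀ {f} n → f 0 ≈ 0# → f n ≈ 0# → Σ< n f ≈ Σ< n (f ∘ suc)
  Σ-shift {f} n f0≈0 fn≈0 = begin
    Σ< n f                  ≈⟨ +-identityʳ _ ⟨
    Σ< n f + 0#             ≈⟨ +-congˡ fn≈0 ⟨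
    Σ< n f + f n            ≈⟨ Σ-head n ⟩
    f 0 + Σ< n (f ∘ suc)    ≈⟨ +-congʳ f0≈0 ⟩
    0# + Σ< n (f ∘ suc)     ≈⟨ +-identityˡ _ ⟩
    Σ< n (f ∘ suc)          ∎

  Σ-only-head : ∀ {f} n → 0 < n → (∀ k → f (suc k) ≈ 0#) → Σ< n f ≈ f 0
  Σ-only-head {f} (suc n) _ f≈0 = trans (Σ-head n) (trans (+-congˡ (Σ-zero n f≈0)) (+-identityʳ (f 0)))

  Σ-++ : ∀ {f} m n → Σ< (m ℕ.+ n) f ≈ Σ< m f + Σ< n (λ k → f (m ℕ.+ k))
  Σ-++ {f} m zero rewrite ℕ.+-identityʳ m = sym (+-identityʳ _)
  Σ-++ {f} m (suc n) rewrite ℕ.+-suc m n = trans (+-congʳ (Σ-++ m n)) (+-assoc _ _ _)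

  Σ-extend : ∀ {f} m n → (∀ k → m ≤ k → f k ≈ 0#) → Σ< (m ℕ.+ n) f ≈ Σ< m f
  Σ-extend m n f≈0 = trans (Σ-++ m n)
    (trans (+-congˡ (Σ-zero n λ k → f≈0 (m ℕ.+ k) (ℕ.m≤m+n m k))) (+-identityʳ _))

  Σ-reverse : ∀ {f} n → Σ< n f ≈ Σ< n (λ k → f (n ∸ suc k))
  Σ-reverse zero    = refl
  Σ-reverse (suc n) = trans (+-congʳ (Σ-reverse n)) (trans (+-comm _ _) (sym (Σ-head n)))

  Σ-pairs : ∀ {f} n → Σ< (n ℕ.+ n) f ≈ Σ< n (λ k → f (k ℕ.+ k) + f (suc (k ℕ.+ k)))
  Σ-pairs zero = refl
  Σ-pairs (suc n) rewrite ℕ.+-suc n n = trans (+-congʳ (+-congʳ (Σ-pairs n))) (+-assoc _ _ _)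

  -- Summation by antidiagonals fills a triangle, and the rest of the square carries only zeros. The
  -- induction peels off the row i = 0.
  Σ-triangle : ∀ n (F : ℕ → ℕ → Carrier) → (∀ i l → n ≤ i ℕ.+ l → F i l ≈ 0#) →
    Σ< n (λ k → Σ< (suc k) (λ i → F i (k ∸ i))) ≈ Σ< n (λ i → Σ< n (F i))
  Σ-triangle zero    F F≈0 = refl
  Σ-triangle (suc n) F F≈0 = begin
    Σ< (suc n) (λ k → Σ< (suc k) (λ i → F i (k ∸ i)))
      ≈⟨ Σ-cong (suc n) (λ k → Σ-head k) ⟩
    Σ< (suc n) (λ k → F 0 k + Σ< k (λ i → F (suc i) (k ∸ suc i)))
      ≈⟨ Σ-+ (suc n) ⟩
    Σ< (suc n) (F 0) + Σ< (suc n) (λ k → Σ< k (λ i → F (suc i) (k ∸ suc i)))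
      ≈⟨ +-congˡ (trans (Σ-head n) (+-identityˡ _)) ⟩
    Σ< (suc n) (F 0) + Σ< n (λ k → Σ< (suc k) (λ i → F (suc i) (k ∸ i)))
      ≈⟨ +-congˡ (Σ-triangle n (F ∘ suc) (λ i l n≤ → F≈0 (suc i) l (s≤s n≤))) ⟩
    Σ< (suc n) (F 0) + Σ< n (λ i → Σ< n (F (suc i)))
      ≈⟨ +-congˡ (Σ-cong n λ i → trans (+-congˡ (F≈0 (suc i) n (s≤s (ℕ.m≤n+m n i)))) (+-identityʳ _)) ⟨
    Σ< (suc n) (F 0) + Σ< n (λ i → Σ< (suc n) (F (suc i)))
      ≈⟨ Σ-head n ⟨
    Σ< (suc n) (λ i → Σ< (suc n) (F i)) ∎

-- Finite q-Pochhammer symbols and their factorisations.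

module QSeries {c ℓ} (R : CommutativeRing c ℓ) where

  open CommutativeRing R
  open import Algebra.Properties.Ring ring
  open import Algebra.Properties.CommutativeSemiring.Exp commutativeSemiring public
  open CommutativeSemigroupDivisibility *-commutativeSemigroup using (∙-cong-∣)
  open import Algebra.Properties.Semiring.Divisibility semiring
  open IntegerSolver R
  open FiniteSums R
  open import Relation.Binary.Reasoning.Setoid setoid

  ^-split : ∀ x {a} b c → a ≡ b ℕ.+ c → x ^ a ≈ x ^ b * x ^ c
  ^-split x b c a≡b+c = trans (^-congʳ x a≡b+c) (^-homo-* x b c)

  1^n≈1 : ∀ n → 1# ^ n ≈ 1#
  1^n≈1 zero    = refl
  1^n≈1 (suc n) = trans (*-identityˡ _) (1^n≈1 n)

  inverse-unique : ∀ {x u w} → u * x ≈ 1# → w * x ≈ 1# → u ≈ w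
  inverse-unique {x} {u} {w} ux≈1 wx≈1 = begin
    u             ≈⟨ *-identityʳ u ⟨
    u * 1#        ≈⟨ *-congˡ wx≈1 ⟨
    u * (w * x)   ≈⟨ solve 3 (λ u w x → u :* (w :* x) := w :* (u :* x)) refl u w x ⟩
    w * (u * x)   ≈⟨ *-congˡ ux≈1 ⟩
    w * 1#        ≈⟨ *-identityʳ w ⟩
    w             ∎

  -- The geometric series telescopes and its remainder is nilpotent. The free `s` is there to
  -- receive the series `inv f`.
  geometric-inverse : ∀ {f s} n → (1# - f) ^ n ≈ 0# → s ≈ Σ< n ((1# - f) ^_) → s * f ≈ 1#
  geometric-inverse {f} {s} n nilpotent s≈ = begin
    s * f                           ≈⟨ *-congʳ s≈ ⟩
    Σ< n ((1# - f) ^_) * f          ≈⟨ telescope n ⟩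
    1# - (1# - f) ^ n               ≈⟨ +-congˡ (trans (-‿cong nilpotent) -0#≈0#) ⟩
    1# + 0#                         ≈⟨ +-identityʳ 1# ⟩
    1#                              ∎
    where
    telescope : ∀ n → Σ< n ((1# - f) ^_) * f ≈ 1# - (1# - f) ^ n
    telescope zero    = trans (zeroˡ f) (sym (-‿inverseʳ 1#))
    telescope (suc n) = trans (distribʳ f _ _) (trans (+-congʳ (telescope n))
      (solve 2 (λ f x → con (+ 1) :- x :+ x :* f := con (+ 1) :- (con (+ 1) :- f) :* x) refl f ((1# - f) ^ n)))

  poch : Carrier → Carrier → ℕ → Carrier
  poch a p zero    = 1#
  poch a p (suc k) = poch a p k * (1# - a * p ^ k)

  -- The homogeneous form z^k (b/z; p)_k, which also makes sense at z = 0.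
  poch₂ : Carrier → Carrier → Carrier → ℕ → Carrier
  poch₂ z b p zero    = 1#
  poch₂ z b p (suc k) = poch₂ z b p k * (z - b * p ^ k)

  poch-cong : ∀ {a a′ p p′} → a ≈ a′ → p ≈ p′ → ∀ k → poch a p k ≈ poch a′ p′ k
  poch-cong a≈ p≈ zero    = refl
  poch-cong a≈ p≈ (suc k) = *-cong (poch-cong a≈ p≈ k) (+-congˡ (-‿cong (*-cong a≈ (^-congˡ k p≈))))

  poch-0# : ∀ p k → poch 0# p k ≈ 1#
  poch-0# p zero    = refl
  poch-0# p (suc k) = trans (*-congʳ (poch-0# p k))
    (solve 1 (λ x → con (+ 1) :* (con (+ 1) :- con (+ 0) :* x) := con (+ 1)) refl (p ^ k))

  poch-suc : ∀ a p k → poch a p (suc k) ≈ (1# - a) * poch (a * p) p k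
  poch-suc a p zero    = solve 1 (λ a → con (+ 1) :* (con (+ 1) :- a :* con (+ 1)) := (con (+ 1) :- a) :* con (+ 1)) refl a
  poch-suc a p (suc k) = trans (*-congʳ (poch-suc a p k))
    (solve 4 (λ a p x P → (con (+ 1) :- a) :* P :* (con (+ 1) :- a :* (p :* x))
                        := (con (+ 1) :- a) :* (P :* (con (+ 1) :- a :* p :* x))) refl a p (p ^ k) (poch (a * p) p k))

  poch₂-scale : ∀ z c p k → poch₂ z (z * c) p k ≈ z ^ k * poch c p k
  poch₂-scale z c p zero    = sym (*-identityˡ 1#)
  poch₂-scale z c p (suc k) = trans (*-congʳ (poch₂-scale z c p k))
    (solve 5 (λ z c x Z P → Z :* P :* (z :- z :* c :* x) := z :* Z :* (P :* (con (+ 1) :- c :* x)))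
      refl z c (p ^ k) (z ^ k) (poch c p k))

  poch₂-cong : ∀ {z b b′} p → b ≈ b′ → ∀ k → poch₂ z b p k ≈ poch₂ z b′ p k
  poch₂-cong p b≈ zero    = refl
  poch₂-cong p b≈ (suc k) = *-cong (poch₂-cong p b≈ k) (+-congˡ (-‿cong (*-congʳ b≈)))

  poch₂-0ʳ : ∀ z p k → poch₂ z 0# p k ≈ z ^ k
  poch₂-0ʳ z p k = begin
    poch₂ z 0# p k           ≈⟨ poch₂-cong p (sym (zeroʳ z)) k ⟩
    poch₂ z (z * 0#) p k     ≈⟨ poch₂-scale z 0# p k ⟩
    z ^ k * poch 0# p k      ≈⟨ *-congˡ (poch-0# p k) ⟩
    z ^ k * 1#               ≈⟨ *-identityʳ _ ⟩
    z ^ k                    ∎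

  ^-double : ∀ {p p²} → p² ≈ p * p → ∀ k → p ^ (k ℕ.+ k) ≈ p² ^ k
  ^-double {p} p²≈ k = trans (^-homo-* p k k) (trans (sym (^-distrib-* p p k)) (^-congˡ k (sym p²≈)))

  -- The factors are sorted by the parity of the exponent of p. Each additional factor joins the two
  -- classes in turn, hence the mutual induction.
  poch-even : ∀ a {p p²} → p² ≈ p * p → ∀ k → poch a p (k ℕ.+ k) ≈ poch a p² k * poch (a * p) p² k
  poch-odd  : ∀ a {p p²} → p² ≈ p * p → ∀ k → poch a p (suc (k ℕ.+ k)) ≈ poch a p² (suc k) * poch (a * p) p² k

  poch-even a p²≈ zero    = sym (*-identityˡ 1#)
  poch-even a {p} {p²} p²≈ (suc k) rewrite ℕ.+-suc k k = begin
    poch a p (suc (k ℕ.+ k)) * (1# - a * (p * p ^ (k ℕ.+ k)))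
      ≈⟨ *-cong (poch-odd a p²≈ k) (+-congˡ (-‿cong (*-congˡ (*-congˡ (^-double p²≈ k))))) ⟩
    poch a p² (suc k) * poch (a * p) p² k * (1# - a * (p * p² ^ k))
      ≈⟨ solve 5 (λ A B a p x → A :* B :* (con (+ 1) :- a :* (p :* x)) := A :* (B :* (con (+ 1) :- a :* p :* x))) refl _ _ a p (p² ^ k) ⟩
    poch a p² (suc k) * (poch (a * p) p² k * (1# - a * p * p² ^ k)) ∎
  poch-odd a {p} {p²} p²≈ k = begin
    poch a p (k ℕ.+ k) * (1# - a * p ^ (k ℕ.+ k))
      ≈⟨ *-cong (poch-even a p²≈ k) (+-congˡ (-‿cong (*-congˡ (^-double p²≈ k)))) ⟩
    poch a p² k * poch (a * p) p² k * (1# - a * p² ^ k)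
      ≈⟨ solve 3 (λ A B x → A :* B :* x := A :* x :* B) refl _ _ _ ⟩
    poch a p² k * (1# - a * p² ^ k) * poch (a * p) p² k ∎

  poch-±  : ∀ a {p p²} → p² ≈ p * p → ∀ k → poch (a * a) p² k ≈ poch a p k * poch (- a) p k
  poch-± a p²≈ zero    = sym (*-identityˡ 1#)
  poch-± a {p} {p²} p²≈ (suc k) = begin
    poch (a * a) p² k * (1# - a * a * p² ^ k)
      ≈⟨ *-cong (poch-± a p²≈ k) (+-congˡ (-‿cong (*-congˡ (trans (^-congˡ k p²≈) (^-distrib-* p p k))))) ⟩
    poch a p k * poch (- a) p k * (1# - a * a * (p ^ k * p ^ k))
      ≈⟨ solve 4 (λ A B a x → A :* B :* (con (+ 1) :- a :* a :* (x :* x))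
                   := A :* (con (+ 1) :- a :* x) :* (B :* (con (+ 1) :- (:- a) :* x))) refl _ _ a (p ^ k) ⟩
    poch a p k * (1# - a * p ^ k) * (poch (- a) p k * (1# - - a * p ^ k)) ∎

  -- Exponents are sorted by residue class modulo 5. With the length written `k ℕ.* 5`, the
  -- successor step unfolds to exactly five new factors, one for each class.
  poch-mod5 : ∀ q k → poch q q (k ℕ.* 5) ≈
    poch q (q ^ 5) k * poch (q ^ 2) (q ^ 5) k * poch (q ^ 3) (q ^ 5) k * poch (q ^ 4) (q ^ 5) k * poch (q ^ 5) (q ^ 5) k
  poch-mod5 q zero    = solve 0 (con (+ 1) := con (+ 1) :* con (+ 1) :* con (+ 1) :* con (+ 1) :* con (+ 1)) refl
  poch-mod5 q (suc k) = trans
    (*-cong (*-cong (*-cong (*-cong (*-cong (poch-mod5 q k)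
      (factor 0)) (factor 1)) (factor 2)) (factor 3)) (factor 4))
    (solve 7 (λ A B C D E q x →
        A :* B :* C :* D :* E
          :* (con (+ 1) :- q :* (q :^ 0 :* x)) :* (con (+ 1) :- q :* (q :^ 1 :* x)) :* (con (+ 1) :- q :* (q :^ 2 :* x))
          :* (con (+ 1) :- q :* (q :^ 3 :* x)) :* (con (+ 1) :- q :* (q :^ 4 :* x))
        := A :* (con (+ 1) :- q :* x) :* (B :* (con (+ 1) :- q :^ 2 :* x)) :* (C :* (con (+ 1) :- q :^ 3 :* x))
          :* (D :* (con (+ 1) :- q :^ 4 :* x)) :* (E :* (con (+ 1) :- q :^ 5 :* x)))
      refl _ _ _ _ _ q ((q ^ 5) ^ k))
    where
    factor : ∀ i → 1# - q * q ^ (i ℕ.+ k ℕ.* 5) ≈ 1# - q * (q ^ i * (q ^ 5) ^ k)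
    factor i = +-congˡ (-‿cong (*-congˡ (trans (^-homo-* q i (k ℕ.* 5))
      (*-congˡ (trans (^-congʳ q (ℕ.*-comm k 5)) (sym (^-assocʳ q 5 k)))))))

  -- Here `v k` plays the role of 1/(p;p)_k. Cancelling its last factor in this way is what produces
  -- the recurrences for sums with such denominators.
  reciprocal-step : ∀ {p} {v : ℕ → Carrier} → (∀ k → v k * poch p p k ≈ 1#) → ∀ k → v (suc k) * (1# - p ^ suc k) ≈ v k
  reciprocal-step {p} {v} v-inv k = inverse-unique
    (trans (solve 3 (λ a b c → a :* b :* c := a :* (c :* b)) refl _ _ _) (v-inv (suc k))) (v-inv k)

  -- Divisibility by powers of a nilpotent q, cancellation, and the q-binomial theorem.

  module Nilpotent (q : Carrier) (M : ℕ) (q^M≈0 : q ^ M ≈ 0#) where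

    ∣-*-+ : ∀ {x y} m n → q ^ m ∣ x → q ^ n ∣ y → q ^ (m ℕ.+ n) ∣ x * y
    ∣-*-+ m n m∣x n∣y = ∣ʳ-respˡ-≈ (sym (^-homo-* q m n)) (∙-cong-∣ m∣x n∣y)

    ∣-*ˡ : ∀ {d x} y → d ∣ x → d ∣ x * y
    ∣-*ˡ {d} {x} y d∣x = ∣ʳ-respʳ-≈ (*-comm y x) (x∣ʳy⇒x∣ʳzy y d∣x)

    ∣-*ʳ : ∀ {d x} y → d ∣ x → d ∣ y * x
    ∣-*ʳ y d∣x = x∣ʳy⇒x∣ʳzy y d∣x

    ∣-+ : ∀ {d x y} → d ∣ x → d ∣ y → d ∣ x + y
    ∣-+ {d} (a , ad≈x) (b , bd≈y) = a + b , trans (distribʳ d a b) (+-cong ad≈x bd≈y)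

    ∣-neg : ∀ {d x} → d ∣ x → d ∣ - x
    ∣-neg {d} (a , ad≈x) = - a , trans (sym (-‿distribˡ-* a d)) (-‿cong ad≈x)

    ∣-^ : ∀ {x} → q ∣ x → ∀ n → q ^ n ∣ x ^ n
    ∣-^ q∣x zero    = 1# , *-identityʳ 1#
    ∣-^ q∣x (suc n) = ∙-cong-∣ q∣x (∣-^ q∣x n)

    q∣q^suc : ∀ n → q ∣ q ^ suc n
    q∣q^suc n = ∣-*ˡ (q ^ n) ∣ʳ-refl

    vanish : ∀ {n x} → M ≤ n → q ^ n ∣ x → x ≈ 0#
    vanish {n} {x} M≤n (a , aq≈x) = begin
      x                            ≈⟨ aq≈x ⟨
      a * q ^ n                    ≈⟨ *-congˡ (^-split q M (n ∸ M) (≡.sym (ℕ.m+[n∸m]≡n M≤n))) ⟩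
      a * (q ^ M * q ^ (n ∸ M))    ≈⟨ *-congˡ (*-congʳ q^M≈0) ⟩
      a * (0# * q ^ (n ∸ M))       ≈⟨ *-congˡ (zeroˡ _) ⟩
      a * 0#                       ≈⟨ zeroʳ a ⟩
      0#                           ∎

    ^-vanish : ∀ {x} → q ∣ x → ∀ {n} → M ≤ n → x ^ n ≈ 0#
    ^-vanish q∣x {n} M≤n = vanish M≤n (∣-^ q∣x n)

    q^-vanish : ∀ {n} → M ≤ n → q ^ n ≈ 0#
    q^-vanish = ^-vanish ∣ʳ-refl

    Unipotent : Carrier → Set _
    Unipotent x = q ∣ 1# - x

    unipotent-* : ∀ {x y} → Unipotent x → Unipotent y → Unipotent (x * y)
    unipotent-* {x} {y} ux uy = ∣ʳ-respʳ-≈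
      (solve 2 (λ x y → (con (+ 1) :- x) :+ x :* (con (+ 1) :- y) := con (+ 1) :- x :* y) refl x y)
      (∣-+ ux (∣-*ʳ x uy))

    unipotent-poch : ∀ {a} p → q ∣ a → ∀ k → Unipotent (poch a p k)
    unipotent-poch p q∣a zero    = ∣ʳ-respʳ-≈ (sym (-‿inverseʳ 1#)) (q ∣0)
    unipotent-poch {a} p q∣a (suc k) = unipotent-* (unipotent-poch p q∣a k)
      (∣ʳ-respʳ-≈ (solve 2 (λ a x → a :* x := con (+ 1) :- (con (+ 1) :- a :* x)) refl a (p ^ k)) (∣-*ˡ (p ^ k) q∣a))

    -- x y = 0 means y = (1 - x) y, and 1 - x is nilpotent.
    unipotent-nonzerodivisor : ∀ {x y} → Unipotent x → x * y ≈ 0# → y ≈ 0#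
    unipotent-nonzerodivisor {x} {y} ux xy≈0 = begin
      y                  ≈⟨ iterate M ⟩
      (1# - x) ^ M * y   ≈⟨ *-congʳ (^-vanish ux ℕ.≤-refl) ⟩
      0# * y             ≈⟨ zeroˡ y ⟩
      0#                 ∎
      where
      iterate : ∀ n → y ≈ (1# - x) ^ n * y
      iterate zero    = sym (*-identityˡ y)
      iterate (suc n) = begin
        y                                          ≈⟨ iterate n ⟩
        (1# - x) ^ n * y                           ≈⟨ +-identityʳ _ ⟨
        (1# - x) ^ n * y + 0#                      ≈⟨ +-congˡ (trans (-‿cong (trans (*-congˡ xy≈0) (zeroʳ _))) -0#≈0#) ⟨
        (1# - x) ^ n * y - (1# - x) ^ n * (x * y)  ≈⟨ solve 3 (λ z x y → z :* y :- z :* (x :* y) := (con (+ 1) :- x) :* z :* y) refl _ x y ⟩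
        (1# - x) * (1# - x) ^ n * y                ∎

    unipotent-cancelˡ : ∀ {x y z} → Unipotent x → x * y ≈ x * z → y ≈ z
    unipotent-cancelˡ {x} {y} {z} ux xy≈xz = begin
      y            ≈⟨ solve 2 (λ y z → y := y :- z :+ z) refl y z ⟩
      y - z + z    ≈⟨ +-congʳ (unipotent-nonzerodivisor ux (trans (x[y-z]≈xy-xz x y z) (trans (+-congʳ xy≈xz) (-‿inverseʳ _)))) ⟩
      0# + z       ≈⟨ +-identityˡ z ⟩
      z            ∎

    -- From exponent M on, p^n vanishes and the factors are 1. Any length at least M therefore
    -- represents the infinite product.
    poch-stable : ∀ a {p} → q ∣ p → ∀ {m n} → M ≤ m → m ≤ n → poch a p n ≈ poch a p m
    poch-stable a {p} q∣p {m} {n} M≤m m≤n = trans (reflexive (≡.cong (poch a p) (≡.sym (ℕ.m+[n∸m]≡n m≤n)))) (go (n ∸ m))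
      where
      go : ∀ t → poch a p (m ℕ.+ t) ≈ poch a p m
      go zero rewrite ℕ.+-identityʳ m = refl
      go (suc t) rewrite ℕ.+-suc m t = begin
        poch a p (m ℕ.+ t) * (1# - a * p ^ (m ℕ.+ t))
          ≈⟨ *-cong (go t) (+-congˡ (-‿cong (*-congˡ (^-vanish q∣p (ℕ.≤-trans M≤m (ℕ.m≤m+n m t)))))) ⟩
        poch a p m * (1# - a * 0#)
          ≈⟨ solve 2 (λ x a → x :* (con (+ 1) :- a :* con (+ 0)) := x) refl _ a ⟩
        poch a p m ∎

    ∣-poch₂ : ∀ {z b} p → q ∣ z → q ∣ b → ∀ k → q ^ k ∣ poch₂ z b p k
    ∣-poch₂ p q∣z q∣b zero    = ∣ʳ-refl
    ∣-poch₂ p q∣z q∣b (suc k) = ∣ʳ-respˡ-≈ (*-comm _ _) (∙-cong-∣ (∣-poch₂ p q∣z q∣b k) (∣-+ q∣z (∣-neg (∣-*ˡ _ q∣b))))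

    module _ {p : Carrier} (q∣p : q ∣ p) {v : ℕ → Carrier} (v-inv : ∀ k → v k * poch p p k ≈ 1#) where

      private
        v-step : ∀ k → v (suc k) * (1# - p ^ suc k) ≈ v k
        v-step = reciprocal-step v-inv

        v0≈1 : v 0 ≈ 1#
        v0≈1 = trans (sym (*-identityʳ _)) (v-inv 0)

      -- The sum with argument scaled by p^k satisfies a first order recurrence in k and is 1 for k ≥ M.
      q-binomial : ∀ {z b} → q ∣ z → q ∣ b → ∀ K L → M ≤ K → M ≤ L → 0 < L →
        poch z p K * Σ< L (λ m → poch₂ z b p m * v m) ≈ poch b p K
      q-binomial {z} {b} q∣z q∣b K L M≤K M≤L 0<L = begin
        poch z p K * Σ< L (λ m → h m * v m)  ≈⟨ *-congˡ (Σ-cong L λ m → trans (sym (*-identityˡ _)) (*-congʳ (sym (1^n≈1 m)))) ⟩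
        poch z p K * B 0                     ≈⟨ iterate K ⟩
        poch b p K * B K                     ≈⟨ *-congˡ B-limit ⟩
        poch b p K * 1#                      ≈⟨ *-identityʳ _ ⟩
        poch b p K                           ∎
        where
        h : ℕ → Carrier
        h = poch₂ z b p

        t : ℕ → ℕ → Carrier
        t k m = (p ^ k) ^ m * (h m * v m)

        B : ℕ → Carrier
        B k = Σ< L (t k)

        -- The difference of the m-th terms contains 1 - p^m, which cancels the last factor of the
        -- denominator. After the index shift, the new factor z - b p^m of `h (suc m)` splits the
        -- sum: p^m turns (p^k)^m into (p^(k+1))^m, hence `B (suc k)`.
        B-diff : ∀ k → B k - B (suc k) ≈ z * p ^ k * B k - b * p ^ k * B (suc k)
        B-diff k = begin
          B k - B (suc k)
            ≈⟨ Σ-- L ⟩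
          Σ< L (λ m → t k m - t (suc k) m)
            ≈⟨ Σ-cong L (λ m → trans (+-congˡ (-‿cong (*-congʳ (^-distrib-* p (p ^ k) m))))
                 (solve 4 (λ P X h v → X :* (h :* v) :- P :* X :* (h :* v) := X :* h :* (v :* (con (+ 1) :- P)))
                    refl (p ^ m) ((p ^ k) ^ m) (h m) (v m))) ⟩
          Σ< L (λ m → (p ^ k) ^ m * h m * (v m * (1# - p ^ m)))
            ≈⟨ Σ-shift L
                 (solve 1 (λ x → con (+ 1) :* con (+ 1) :* (x :* (con (+ 1) :- con (+ 1))) := con (+ 0)) refl (v 0))
                 (trans (*-congʳ (trans (*-congˡ (vanish M≤L (∣-poch₂ p q∣z q∣b L))) (zeroʳ _))) (zeroˡ _)) ⟩
          Σ< L (λ m → (p ^ k) ^ suc m * h (suc m) * (v (suc m) * (1# - p ^ suc m)))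
            ≈⟨ Σ-cong L (λ m → trans (*-congˡ (v-step m))
                 (trans (solve 7 (λ P K X h z b v → P :* X :* (h :* (z :- b :* K)) :* v
                           := z :* P :* (X :* (h :* v)) :- b :* P :* (K :* X :* (h :* v)))
                         refl (p ^ k) (p ^ m) ((p ^ k) ^ m) (h m) z b (v m))
                   (+-congˡ (-‿cong (*-congˡ (*-congʳ (sym (^-distrib-* p (p ^ k) m)))))))) ⟩
          Σ< L (λ m → z * p ^ k * t k m - b * p ^ k * t (suc k) m)
            ≈⟨ Σ-- L ⟨
          Σ< L (λ m → z * p ^ k * t k m) - Σ< L (λ m → b * p ^ k * t (suc k) m)
            ≈⟨ +-cong (Σ-*ˡ _ L) (-‿cong (Σ-*ˡ _ L)) ⟨
          z * p ^ k * B k - b * p ^ k * B (suc k) ∎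

        B-step : ∀ k → (1# - z * p ^ k) * B k ≈ (1# - b * p ^ k) * B (suc k)
        B-step k = begin
          (1# - z * p ^ k) * B k
            ≈⟨ solve 3 (λ Z B B′ → (con (+ 1) :- Z) :* B := B :- B′ :+ (B′ :- Z :* B)) refl (z * p ^ k) (B k) (B (suc k)) ⟩
          B k - B (suc k) + (B (suc k) - z * p ^ k * B k)
            ≈⟨ +-congʳ (B-diff k) ⟩
          z * p ^ k * B k - b * p ^ k * B (suc k) + (B (suc k) - z * p ^ k * B k)
            ≈⟨ solve 4 (λ Z C B B′ → Z :* B :- C :* B′ :+ (B′ :- Z :* B) := (con (+ 1) :- C) :* B′)
                 refl (z * p ^ k) (b * p ^ k) (B k) (B (suc k)) ⟩
          (1# - b * p ^ k) * B (suc k) ∎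

        iterate : ∀ k → poch z p k * B 0 ≈ poch b p k * B k
        iterate zero    = refl
        iterate (suc k) = begin
          poch z p k * (1# - z * p ^ k) * B 0      ≈⟨ solve 3 (λ x y z → x :* y :* z := y :* (x :* z)) refl _ _ _ ⟩
          (1# - z * p ^ k) * (poch z p k * B 0)    ≈⟨ *-congˡ (iterate k) ⟩
          (1# - z * p ^ k) * (poch b p k * B k)    ≈⟨ solve 3 (λ x y z → x :* (y :* z) := y :* (x :* z)) refl _ _ _ ⟩
          poch b p k * ((1# - z * p ^ k) * B k)    ≈⟨ *-congˡ (B-step k) ⟩
          poch b p k * ((1# - b * p ^ k) * B (suc k))  ≈⟨ *-assoc _ _ _ ⟨
          poch b p k * (1# - b * p ^ k) * B (suc k)    ∎

        B-limit : B K ≈ 1#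
        B-limit = begin
          B K              ≈⟨ Σ-only-head L 0<L (λ m → trans (*-congʳ (trans (*-congʳ (^-vanish q∣p M≤K)) (zeroˡ _))) (zeroˡ _)) ⟩
          1# * (1# * v 0)  ≈⟨ *-congˡ (*-congˡ v0≈1) ⟩
          1# * (1# * 1#)   ≈⟨ trans (*-identityˡ _) (*-identityˡ _) ⟩
          1#               ∎

      -- The Jacobi triple product, as a sum over m, n ≥ 0 without negative powers.

      private
        -- W x y m n is the term of index m - n in Σ_{j ∈ ℤ} (-x)^j p^(j(j-1)/2), with x⁻¹ read as y/p.
        W : Carrier → Carrier → ℕ → ℕ → Carrier
        W x y zero    n       = poch₂ 0# y p n
        W x y (suc m) zero    = poch₂ 0# x p (suc m)
        W x y (suc m) (suc n) = W x y m n

        W-left : ∀ x y m n → W x y m (m ℕ.+ n) ≡ poch₂ 0# y p n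
        W-left x y zero    n = ≡.refl
        W-left x y (suc m) n = W-left x y m n

        W-right : ∀ x y m n → W x y (n ℕ.+ m) n ≡ poch₂ 0# x p m
        W-right x y zero    zero    = ≡.refl
        W-right x y (suc m) zero    = ≡.refl
        W-right x y m       (suc n) = W-right x y m n

        -- Neighbouring theta terms, of index m - n and m - n - 1, have ratio -y p^(n-m);
        -- multiplying through by p^m keeps all exponents nonnegative.
        W-suc : ∀ {x y} → x * y ≈ p → ∀ m n → W x y m n * (y * p ^ n) ≈ - (p ^ m * W x y m (suc n))
        W-suc {x} {y} xy≈p zero n = solve 3 (λ h y P → h :* (y :* P) := :- (con (+ 1) :* (h :* (con (+ 0) :- y :* P)))) refl _ y (p ^ n)
        W-suc {x} {y} xy≈p (suc m) zero = begin
          poch₂ 0# x p m * (0# - x * p ^ m) * (y * 1#)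
            ≈⟨ solve 4 (λ h x P y → h :* (con (+ 0) :- x :* P) :* (y :* con (+ 1)) := :- (x :* y :* P :* h)) refl _ x _ y ⟩
          - (x * y * p ^ m * poch₂ 0# x p m)
            ≈⟨ -‿cong (*-cong (*-congʳ xy≈p) (reflexive (≡.sym (W-right x y m 0)))) ⟩
          - (p * p ^ m * W x y m 0) ∎
        W-suc {x} {y} xy≈p (suc m) (suc n) = begin
          W x y m n * (y * (p * p ^ n))          ≈⟨ solve 4 (λ w y p P → w :* (y :* (p :* P)) := p :* (w :* (y :* P))) refl _ y p _ ⟩
          p * (W x y m n * (y * p ^ n))          ≈⟨ *-congˡ (W-suc xy≈p m n) ⟩
          p * - (p ^ m * W x y m (suc n))        ≈⟨ solve 3 (λ p P w → p :* :- (P :* w) := :- (p :* P :* w)) refl p _ _ ⟩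
          - (p * p ^ m * W x y m (suc n))        ∎

      -- Start from Euler's series for (x;p)_∞ and multiply in the factors 1 - y p^n one by one.
      -- After n of them the sum is Σ_m W(m,n)/(p;p)_m. For n = K every term that survives has m ≥
      -- M, where 1/(p;p)_m is the constant 1/(p;p)_∞, so multiplication by (p;p)_∞ leaves the bare
      -- theta series.
      jacobi-triple-product : ∀ {x y} → x * y ≈ p → q ∣ x → q ∣ y → 0 < M → let K = M ℕ.+ M in
        poch p p K * poch x p K * poch y p K ≈ Σ< K (λ r → poch₂ 0# x p r + poch₂ 0# y p (suc r))
      jacobi-triple-product {x} {y} xy≈p q∣x q∣y 0<M = begin
        P * poch x p K * poch y p K
          ≈⟨ solve 3 (λ a b c → a :* b :* c := c :* b :* a) refl _ _ _ ⟩
        poch y p K * poch x p K * P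
          ≈⟨ *-congʳ (*-congˡ euler) ⟩
        poch y p K * S 0 * P
          ≈⟨ *-congʳ (iterate K ℕ.≤-refl) ⟩
        S K * P
          -- At m = K the theta index m - K changes sign; the lower half is then reversed so that it
          -- counts away from 0.
          ≈⟨ *-congʳ (Σ-++ K K) ⟩
        (Σ< K (λ m → t K m) + Σ< K (λ r → t K (K ℕ.+ r))) * P
          ≈⟨ distribʳ P _ _ ⟩
        Σ< K (λ m → t K m) * P + Σ< K (λ r → t K (K ℕ.+ r)) * P
          ≈⟨ +-cong (trans (*-congʳ (Σ-reverse K)) (Σ-*ʳ P K)) (Σ-*ʳ P K) ⟩
        Σ< K (λ r → t K (K ∸ suc r) * P) + Σ< K (λ r → t K (K ℕ.+ r) * P)
          ≈⟨ +-cong (Σ-cong< K left) (Σ-cong K right) ⟩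
        Σ< K (λ r → poch₂ 0# y p (suc r)) + Σ< K (λ r → poch₂ 0# x p r)
          ≈⟨ trans (+-comm _ _) (sym (Σ-+ K)) ⟩
        Σ< K (λ r → poch₂ 0# x p r + poch₂ 0# y p (suc r)) ∎
        where
        K L : ℕ
        K = M ℕ.+ M
        -- Twice K, so that for every n < K the boundary index L - n - 1 is still at least M and the
        -- boundary term vanishes.
        L = K ℕ.+ K

        M≤K : M ≤ K
        M≤K = ℕ.m≤m+n M M

        P : Carrier
        P = poch p p K

        t : ℕ → ℕ → Carrier
        t n m = W x y m n * v m

        S : ℕ → Carrier
        S n = Σ< L (t n)

        euler : poch x p K ≈ S 0
        euler = begin
          poch x p K
            ≈⟨ q-binomial (q ∣0) q∣x K L M≤K (ℕ.≤-trans M≤K (ℕ.m≤m+n K K)) (ℕ.≤-trans 0<M (ℕ.≤-trans M≤K (ℕ.m≤m+n K K))) ⟨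
          poch 0# p K * Σ< L (λ m → poch₂ 0# x p m * v m)
            ≈⟨ *-cong (poch-0# p K) (Σ-cong L λ m → *-congʳ (reflexive (≡.sym (W-right x y m 0)))) ⟩
          1# * S 0
            ≈⟨ *-identityˡ _ ⟩
          S 0 ∎

        boundary : ∀ n → n < K → W x y L (suc n) ≈ 0#
        boundary n n<K = begin
          W x y L (suc n)                        ≡⟨ ≡.cong (λ l → W x y l (suc n)) (≡.sym (ℕ.m+[n∸m]≡n n<L)) ⟩
          W x y (suc n ℕ.+ (L ∸ suc n)) (suc n)  ≡⟨ W-right x y (L ∸ suc n) (suc n) ⟩
          poch₂ 0# x p (L ∸ suc n)               ≈⟨ vanish M≤ (∣-poch₂ p (q ∣0) q∣x (L ∸ suc n)) ⟩
          0#                                     ∎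
          where
          n<L : suc n ≤ L
          n<L = ℕ.≤-trans n<K (ℕ.m≤m+n K K)
          M≤ : M ≤ L ∸ suc n
          M≤ = ℕ.≤-trans M≤K (ℕ.≤-trans (ℕ.≤-reflexive (≡.sym (ℕ.m+n∸n≡m K K))) (ℕ.∸-monoʳ-≤ L n<K))

        -- In `S n` itself, W(m,n) = W(m+1,n+1), and raising the denominator before shifting m gives
        -- the weight 1 - p^m. The part multiplied by y p^n contributes the weight p^m through
        -- `W-suc`. The weights add up to 1.
        step : ∀ n → n < K → (1# - y * p ^ n) * S n ≈ S (suc n)
        step n n<K = begin
          (1# - y * p ^ n) * S n
            ≈⟨ solve 2 (λ a s → (con (+ 1) :- a) :* s := s :- s :* a) refl (y * p ^ n) (S n) ⟩
          S n - S n * (y * p ^ n)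
            ≈⟨ +-congˡ (-‿cong (Σ-*ʳ _ L)) ⟩
          S n - Σ< L (λ m → t n m * (y * p ^ n))
            ≈⟨ +-cong (Σ-cong L (λ m → *-congˡ (sym (v-step m))))
                 (-‿cong (Σ-cong L (λ m → trans (solve 3 (λ w v y → w :* v :* y := w :* y :* v) refl _ _ _) (*-congʳ (W-suc xy≈p m n))))) ⟩
          Σ< L (λ m → W x y m n * (v (suc m) * (1# - p ^ suc m))) - Σ< L (λ m → - (p ^ m * W x y m (suc n)) * v m)
            ≈⟨ +-congʳ (Σ-shift L
                 (trans (*-congˡ (trans (*-congˡ (-‿inverseʳ 1#)) (zeroʳ _))) (zeroʳ _))
                 (trans (*-congʳ (boundary n n<K)) (zeroˡ _))) ⟨
          Σ< L (λ m → W x y m (suc n) * (v m * (1# - p ^ m))) - Σ< L (λ m → - (p ^ m * W x y m (suc n)) * v m)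
            ≈⟨ Σ-- L ⟩
          Σ< L (λ m → W x y m (suc n) * (v m * (1# - p ^ m)) - - (p ^ m * W x y m (suc n)) * v m)
            ≈⟨ Σ-cong L (λ m → solve 3 (λ w v P → w :* (v :* (con (+ 1) :- P)) :- (:- (P :* w)) :* v := w :* v) refl _ (v m) (p ^ m)) ⟩
          S (suc n) ∎

        iterate : ∀ n → n ≤ K → poch y p n * S 0 ≈ S n
        iterate zero    _   = *-identityˡ _
        iterate (suc n) n<K = begin
          poch y p n * (1# - y * p ^ n) * S 0    ≈⟨ solve 3 (λ x y z → x :* y :* z := y :* (x :* z)) refl _ _ _ ⟩
          (1# - y * p ^ n) * (poch y p n * S 0)  ≈⟨ *-congˡ (iterate n (ℕ.<⇒≤ n<K)) ⟩
          (1# - y * p ^ n) * S n                 ≈⟨ step n n<K ⟩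
          S (suc n)                              ∎

        v*P≈1 : ∀ m → M ≤ m → v m * P ≈ 1#
        v*P≈1 m M≤m = trans (*-congˡ (trans (poch-stable p q∣p ℕ.≤-refl M≤K) (sym (poch-stable p q∣p ℕ.≤-refl M≤m)))) (v-inv m)

        right : ∀ r → t K (K ℕ.+ r) * P ≈ poch₂ 0# x p r
        right r = trans (*-assoc _ _ _) (trans (*-cong (reflexive (W-right x y r K)) (v*P≈1 (K ℕ.+ r) (ℕ.≤-trans M≤K (ℕ.m≤m+n K r)))) (*-identityʳ _))

        W-reversed : ∀ r → r < K → W x y (K ∸ suc r) K ≈ poch₂ 0# y p (suc r)
        W-reversed r r<K = reflexive (≡.trans
          (≡.cong (W x y (K ∸ suc r)) (≡.sym (ℕ.m∸n+n≡m r<K))) (W-left x y (K ∸ suc r) (suc r)))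

        left : ∀ r → r < K → t K (K ∸ suc r) * P ≈ poch₂ 0# y p (suc r)
        -- Since K = 2M, either m = K - r - 1 is at least M and `v m` has reached its limit, or r +
        -- 1 ≥ M and both sides vanish.
        left r r<K with ℕ.≤-total M (K ∸ suc r)
        ... | inj₁ M≤ = trans (*-assoc _ _ _) (trans (*-cong (W-reversed r r<K) (v*P≈1 _ M≤)) (*-identityʳ _))
        ... | inj₂ ≤M = trans (trans (*-assoc _ _ _) (trans (*-congʳ (trans (W-reversed r r<K) ≈0)) (zeroˡ _))) (sym ≈0)
          where
          M≤sr : M ≤ suc r
          M≤sr = ℕ.+-cancelˡ-≤ M M (suc r) (ℕ.≤-trans (ℕ.≤-reflexive (≡.sym (ℕ.m∸n+n≡m r<K))) (ℕ.+-monoˡ-≤ (suc r) ≤M))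
          ≈0 : poch₂ 0# y p (suc r) ≈ 0#
          ≈0 = vanish M≤sr (∣-poch₂ p (q ∣0) q∣y (suc r))

-- Rogers' series: recurrence, limit, and product form.

module Theta {c ℓ} (R : CommutativeRing c ℓ) where

  open CommutativeRing R
  open import Algebra.Properties.Ring ring
  open import Algebra.Properties.Semiring.Divisibility semiring
  open IntegerSolver R
  open FiniteSums R
  open QSeries R
  open import Relation.Binary.Reasoning.Setoid setoid

  module _ (q : Carrier) (M : ℕ) (q^M≈0 : q ^ M ≈ 0#) (0<M : 0 < M) where
    open Nilpotent q M q^M≈0

    private
      K : ℕ
      K = M ℕ.+ M

      M≤K : M ≤ K
      M≤K = ℕ.m≤m+n M M

      0<K : 0 < K
      0<K = ℕ.≤-trans 0<M M≤K

      -- (-1)^r q^(r(5r+1)/2)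
      s : ℕ → Carrier
      s = poch₂ 0# (q ^ 3) (q ^ 5)

      s-suc : ∀ r → s (suc r) ≈ - (s r * (q ^ 3 * (q ^ r) ^ 5))
      s-suc r = trans (*-congˡ (+-congˡ (-‿cong (*-congˡ (trans (^-assocʳ q 5 r)
          (trans (^-congʳ q (ℕ.*-comm 5 r)) (sym (^-assocʳ q r 5))))))))
        (solve 2 (λ s x → s :* (con (+ 0) :- x) := :- (s :* x)) refl (s r) _)

      s-vanish : ∀ x y → s K * x * y ≈ 0#
      s-vanish x y = trans (*-congʳ (trans (*-congʳ (vanish M≤K (∣-poch₂ (q ^ 5) (q ∣0) (∣-*ˡ _ ∣ʳ-refl) K))) (zeroˡ x))) (zeroˡ y)

      head-vanish : ∀ x y → x * y * (1# - 1#) ≈ 0#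
      head-vanish x y = trans (*-congˡ (-‿inverseʳ 1#)) (zeroʳ _)

    -- At x = q^k these are (q;q)_∞ times the Rogers-Selberg functions Q_(2,2)(x) and Q_(2,1)(x).
    -- The quotient (q;q)_∞ / ((q;q)_r (x q^(r+1);q)_∞) has become the polynomial (q^(r+1);q)_k, so
    -- no denominators remain.
    θ η : ℕ → Carrier
    θ k = Σ< K λ r → s r * (q ^ k) ^ (r ℕ.+ r) * (poch (q ^ suc r) q k * (1# - q ^ 2 * (q ^ k) ^ 2 * (q ^ r) ^ 4))
    η k = Σ< K λ r → s r * q ^ r * (q ^ k) ^ (r ℕ.+ r) * (poch (q ^ suc r) q k * (1# - q * q ^ k * (q ^ r) ^ 2))

    private
      -- A term shifted from r to r + 1 is completed at the front, an unshifted one at the back.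
      -- Both then share the same product of length k + 1 and can be added.
      front : ∀ k r → (1# - q ^ suc r) * poch (q ^ suc (suc r)) q k ≈ poch (q ^ suc r) q (suc k)
      front k r = sym (trans (poch-suc (q ^ suc r) q k) (*-congˡ (poch-cong (*-comm _ _) refl k)))

      back : ∀ k r → poch (q ^ suc r) q k * (1# - q * q ^ k * q ^ r) ≈ poch (q ^ suc r) q (suc k)
      back k r = *-congˡ (+-congˡ (-‿cong (solve 3 (λ q K R → q :* K :* R := q :* R :* K) refl q _ _)))

      double-suc : ∀ x r → x ^ (suc r ℕ.+ suc r) ≈ x ^ 2 * x ^ (r ℕ.+ r)
      double-suc x r = ^-split x 2 (r ℕ.+ r) (≡.cong suc (ℕ.+-suc r r))

      double-* : ∀ r k → (q ^ suc k) ^ (r ℕ.+ r) ≈ (q ^ r) ^ 2 * (q ^ k) ^ (r ℕ.+ r)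
      double-* r k = trans (^-distrib-* q (q ^ k) (r ℕ.+ r)) (*-congʳ (trans (^-homo-* q r r)
        (*-congˡ (sym (*-identityʳ _)))))

    -- With x = q^k and R = q^r, the key identity is (1 - q^2 x^2 R^4) - R (1 - q x R^2) = (1 - R) +
    -- q x R^3 (1 - q x R). The part with 1 - R is shifted in r, and both parts then extend the
    -- Pochhammer product by one factor.
    θ-step : ∀ k → θ k ≈ η k + q ^ suc k * η (suc k)
    θ-step k = begin
      θ k
        ≈⟨ solve 2 (λ a b → a := b :+ (a :- b)) refl (θ k) (η k) ⟩
      η k + (θ k - η k)
        ≈⟨ +-congˡ (Σ-- K) ⟩
      η k + Σ< K _
        ≈⟨ +-congˡ (Σ-cong K λ r → solve 6 (λ s X R A q K →
             s :* X :* (A :* (con (+ 1) :- q :^ 2 :* K :^ 2 :* R :^ 4)) :- s :* R :* X :* (A :* (con (+ 1) :- q :* K :* R :^ 2))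
             := s :* X :* A :* (con (+ 1) :- R) :+ s :* X :* (q :* K :* R :^ 3) :* (A :* (con (+ 1) :- q :* K :* R)))
           refl (s r) ((q ^ k) ^ (r ℕ.+ r)) (q ^ r) (poch (q ^ suc r) q k) q (q ^ k)) ⟩
      η k + Σ< K (λ r → s r * (q ^ k) ^ (r ℕ.+ r) * poch (q ^ suc r) q k * (1# - q ^ r)
                          + s r * (q ^ k) ^ (r ℕ.+ r) * (q * q ^ k * (q ^ r) ^ 3) * (poch (q ^ suc r) q k * (1# - q * q ^ k * q ^ r)))
        ≈⟨ +-congˡ (trans (Σ-+ K) (+-congʳ (Σ-shift K (head-vanish _ _) (trans (*-congʳ (s-vanish _ _)) (zeroˡ _))))) ⟩
      η k + (Σ< K _ + Σ< K _)
        ≈⟨ +-congˡ (trans (sym (Σ-+ K)) (Σ-cong K term)) ⟩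
      η k + Σ< K (λ r → q ^ suc k * (s r * q ^ r * (q ^ suc k) ^ (r ℕ.+ r)
                          * (poch (q ^ suc r) q (suc k) * (1# - q * q ^ suc k * (q ^ r) ^ 2))))
        ≈⟨ +-congˡ (Σ-*ˡ _ K) ⟨
      η k + q ^ suc k * η (suc k) ∎
      where
      term : ∀ r → _
      term r = begin
        s (suc r) * (q ^ k) ^ (suc r ℕ.+ suc r) * poch (q ^ suc (suc r)) q k * (1# - q ^ suc r)
          + s r * (q ^ k) ^ (r ℕ.+ r) * (q * q ^ k * (q ^ r) ^ 3) * (poch (q ^ suc r) q k * (1# - q * q ^ k * q ^ r))
          ≈⟨ +-cong (trans (solve 4 (λ a b c d → a :* b :* c :* d := a :* b :* (d :* c)) refl _ _ _ _)
                      (*-cong (*-cong (s-suc r) (double-suc (q ^ k) r)) (front k r)))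
                    (*-congˡ (back k r)) ⟩
        - (s r * (q ^ 3 * (q ^ r) ^ 5)) * ((q ^ k) ^ 2 * (q ^ k) ^ (r ℕ.+ r)) * A
          + s r * (q ^ k) ^ (r ℕ.+ r) * (q * q ^ k * (q ^ r) ^ 3) * A
          ≈⟨ solve 6 (λ s X R A q K →
               :- (s :* (q :^ 3 :* R :^ 5)) :* (K :^ 2 :* X) :* A :+ s :* X :* (q :* K :* R :^ 3) :* A
               := q :* K :* (s :* R :* (R :^ 2 :* X) :* (A :* (con (+ 1) :- q :* (q :* K) :* R :^ 2))))
               refl (s r) ((q ^ k) ^ (r ℕ.+ r)) (q ^ r) A q (q ^ k) ⟩
        q ^ suc k * (s r * q ^ r * ((q ^ r) ^ 2 * (q ^ k) ^ (r ℕ.+ r)) * (A * (1# - q * q ^ suc k * (q ^ r) ^ 2)))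
          ≈⟨ *-congˡ (*-congʳ (*-congˡ (double-* r k))) ⟨
        q ^ suc k * (s r * q ^ r * (q ^ suc k) ^ (r ℕ.+ r) * (A * (1# - q * q ^ suc k * (q ^ r) ^ 2))) ∎
        where
        A : Carrier
        A = poch (q ^ suc r) q (suc k)

    -- The same mechanism, with R (1 - q x R^2) = R (1 - R) + R^2 (1 - q x R).
    η-step : ∀ k → η k ≈ θ (suc k)
    η-step k = begin
      η k
        ≈⟨ Σ-cong K (λ r → solve 6 (λ s X R A q K →
             s :* R :* X :* (A :* (con (+ 1) :- q :* K :* R :^ 2))
             := s :* (R :* X) :* A :* (con (+ 1) :- R) :+ s :* X :* R :^ 2 :* (A :* (con (+ 1) :- q :* K :* R)))
           refl (s r) ((q ^ k) ^ (r ℕ.+ r)) (q ^ r) (poch (q ^ suc r) q k) q (q ^ k)) ⟩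
      Σ< K (λ r → s r * (q ^ r * (q ^ k) ^ (r ℕ.+ r)) * poch (q ^ suc r) q k * (1# - q ^ r)
                    + s r * (q ^ k) ^ (r ℕ.+ r) * (q ^ r) ^ 2 * (poch (q ^ suc r) q k * (1# - q * q ^ k * q ^ r)))
        ≈⟨ trans (Σ-+ K) (+-congʳ (Σ-shift K (head-vanish _ _) (trans (*-congʳ (s-vanish _ _)) (zeroˡ _)))) ⟩
      Σ< K _ + Σ< K _
        ≈⟨ trans (sym (Σ-+ K)) (Σ-cong K term) ⟩
      θ (suc k) ∎
      where
      term : ∀ r → _
      term r = begin
        s (suc r) * (q ^ suc r * (q ^ k) ^ (suc r ℕ.+ suc r)) * poch (q ^ suc (suc r)) q k * (1# - q ^ suc r)
          + s r * (q ^ k) ^ (r ℕ.+ r) * (q ^ r) ^ 2 * (poch (q ^ suc r) q k * (1# - q * q ^ k * q ^ r))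
          ≈⟨ +-cong (trans (solve 4 (λ a b c d → a :* b :* c :* d := a :* b :* (d :* c)) refl _ _ _ _)
                      (*-cong (*-cong (s-suc r) (*-congˡ (double-suc (q ^ k) r))) (front k r)))
                    (*-congˡ (back k r)) ⟩
        - (s r * (q ^ 3 * (q ^ r) ^ 5)) * (q ^ suc r * ((q ^ k) ^ 2 * (q ^ k) ^ (r ℕ.+ r))) * A
          + s r * (q ^ k) ^ (r ℕ.+ r) * (q ^ r) ^ 2 * A
          ≈⟨ solve 6 (λ s X R A q K →
               :- (s :* (q :^ 3 :* R :^ 5)) :* (q :* R :* (K :^ 2 :* X)) :* A :+ s :* X :* R :^ 2 :* A
               := s :* (R :^ 2 :* X) :* (A :* (con (+ 1) :- q :^ 2 :* (q :* K) :^ 2 :* R :^ 4)))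
               refl (s r) ((q ^ k) ^ (r ℕ.+ r)) (q ^ r) A q (q ^ k) ⟩
        s r * ((q ^ r) ^ 2 * (q ^ k) ^ (r ℕ.+ r)) * (A * (1# - q ^ 2 * (q ^ suc k) ^ 2 * (q ^ r) ^ 4))
          ≈⟨ *-congʳ (*-congˡ (double-* r k)) ⟨
        s r * (q ^ suc k) ^ (r ℕ.+ r) * (A * (1# - q ^ 2 * (q ^ suc k) ^ 2 * (q ^ r) ^ 4)) ∎
        where
        A : Carrier
        A = poch (q ^ suc r) q (suc k)

    θ-recurrence : ∀ k → θ k ≈ θ (suc k) + q ^ suc k * θ (suc (suc k))
    θ-recurrence k = trans (θ-step k) (+-cong (η-step k) (*-congˡ (η-step (suc k))))

    θ-limit : ∀ k → M ≤ k → θ k ≈ poch q q M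
    θ-limit k M≤k = begin
      θ k
        ≈⟨ Σ-only-head K 0<K (λ r → trans (*-congʳ (trans (*-congˡ (trans (*-congʳ (q^-vanish M≤k)) (zeroˡ _))) (zeroʳ _))) (zeroˡ _)) ⟩
      1# * 1# * (poch (q * 1#) q k * (1# - q ^ 2 * (q ^ k) ^ 2 * 1# ^ 4))
        ≈⟨ *-congˡ (*-cong (poch-cong (*-identityʳ q) refl k) (+-congˡ (-‿cong (*-congʳ (*-congˡ (*-congʳ (q^-vanish M≤k))))))) ⟩
      1# * 1# * (poch q q k * (1# - q ^ 2 * (0# * (q ^ k * 1#)) * 1# ^ 4))
        ≈⟨ solve 3 (λ P q Q → con (+ 1) :* con (+ 1) :* (P :* (con (+ 1) :- q :* (con (+ 0) :* Q) :* con (+ 1) :^ 4)) := P) refl _ (q ^ 2) _ ⟩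
      poch q q k
        ≈⟨ poch-stable q ∣ʳ-refl ℕ.≤-refl M≤k ⟩
      poch q q M ∎

    private
      -- The exponent r(5r+1)/2 + 4r + 2 is the value of n(5n+1)/2 at n = -(r+1). The subtracted
      -- half of each term of θ_0 is thus the negative half of a bilateral theta series.
      s-mirror : ∀ r → s r * (q ^ 2 * (q ^ r) ^ 4) ≈ - poch₂ 0# (q ^ 2) (q ^ 5) (suc r)
      s-mirror zero = solve 1 (λ q → con (+ 1) :* (q :^ 2 :* con (+ 1) :^ 4)
        := :- (con (+ 1) :* (con (+ 0) :- q :^ 2 :* con (+ 1)))) refl q
      s-mirror (suc r) = begin
        s r * (0# - q ^ 3 * (q ^ 5) ^ r) * (q ^ 2 * (q * q ^ r) ^ 4)
          ≈⟨ solve 4 (λ s q P R → s :* (con (+ 0) :- q :^ 3 :* P) :* (q :^ 2 :* (q :* R) :^ 4)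
               := :- (s :* (q :^ 2 :* R :^ 4)) :* (q :^ 2 :* (q :^ 5 :* P))) refl (s r) q _ _ ⟩
        - (s r * (q ^ 2 * (q ^ r) ^ 4)) * (q ^ 2 * (q ^ 5 * (q ^ 5) ^ r))
          ≈⟨ *-congʳ (-‿cong (s-mirror r)) ⟩
        - - poch₂ 0# (q ^ 2) (q ^ 5) (suc r) * (q ^ 2 * (q ^ 5 * (q ^ 5) ^ r))
          ≈⟨ solve 2 (λ a b → :- :- a :* b := :- (a :* (con (+ 0) :- b))) refl _ _ ⟩
        - poch₂ 0# (q ^ 2) (q ^ 5) (suc (suc r)) ∎

      s*q^r : ∀ r → s r * q ^ r ≈ poch₂ 0# (q ^ 4) (q ^ 5) r
      s*q^r zero = *-identityʳ 1#
      s*q^r (suc r) = trans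
        (solve 4 (λ s q P R → s :* (con (+ 0) :- q :^ 3 :* P) :* (q :* R) := s :* R :* (con (+ 0) :- q :^ 4 :* P)) refl (s r) q _ _)
        (*-congʳ (s*q^r r))

      -- The same reflection n = -(r+1), now for the exponent n(5n+3)/2.
      s-mirror′ : ∀ r → s r * q ^ r * (q * (q ^ r) ^ 2) ≈ - poch₂ 0# q (q ^ 5) (suc r)
      s-mirror′ zero = solve 1 (λ q → con (+ 1) :* con (+ 1) :* (q :* con (+ 1) :^ 2)
        := :- (con (+ 1) :* (con (+ 0) :- q :* con (+ 1)))) refl q
      s-mirror′ (suc r) = begin
        s r * (0# - q ^ 3 * (q ^ 5) ^ r) * (q * q ^ r) * (q * (q * q ^ r) ^ 2)
          ≈⟨ solve 4 (λ s q P R → s :* (con (+ 0) :- q :^ 3 :* P) :* (q :* R) :* (q :* (q :* R) :^ 2)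
               := :- (s :* R :* (q :* R :^ 2)) :* (q :* (q :^ 5 :* P))) refl (s r) q _ _ ⟩
        - (s r * q ^ r * (q * (q ^ r) ^ 2)) * (q * (q ^ 5 * (q ^ 5) ^ r))
          ≈⟨ *-congʳ (-‿cong (s-mirror′ r)) ⟩
        - - poch₂ 0# q (q ^ 5) (suc r) * (q * (q ^ 5 * (q ^ 5) ^ r))
          ≈⟨ solve 2 (λ a b → :- :- a :* b := :- (a :* (con (+ 0) :- b))) refl _ _ ⟩
        - poch₂ 0# q (q ^ 5) (suc (suc r)) ∎

    module _ {v : ℕ → Carrier} (v-inv : ∀ k → v k * poch (q ^ 5) (q ^ 5) k ≈ 1#) where

      θ₀-product : θ 0 ≈ poch (q ^ 5) (q ^ 5) K * poch (q ^ 3) (q ^ 5) K * poch (q ^ 2) (q ^ 5) K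
      θ₀-product = begin
        θ 0
          ≈⟨ Σ-cong K (λ r → trans (*-congʳ (*-congˡ (1^n≈1 (r ℕ.+ r))))
               (trans (solve 3 (λ s Q R → s :* con (+ 1) :* (con (+ 1) :* (con (+ 1) :- Q :* con (+ 1) :^ 2 :* R)) := s :- s :* (Q :* R))
                 refl (s r) (q ^ 2) ((q ^ r) ^ 4))
               (+-congˡ (trans (-‿cong (s-mirror r)) (-‿involutive _))))) ⟩
        Σ< K (λ r → s r + poch₂ 0# (q ^ 2) (q ^ 5) (suc r))
          ≈⟨ jacobi-triple-product (q∣q^suc 4) v-inv (sym (^-homo-* q 3 2)) (q∣q^suc 2) (q∣q^suc 1) 0<M ⟨
        poch (q ^ 5) (q ^ 5) K * poch (q ^ 3) (q ^ 5) K * poch (q ^ 2) (q ^ 5) K ∎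

      θ₁-product : θ 1 ≈ poch (q ^ 5) (q ^ 5) K * poch (q ^ 4) (q ^ 5) K * poch q (q ^ 5) K
      θ₁-product = begin
        θ 1
          ≈⟨ η-step 0 ⟨
        η 0
          ≈⟨ Σ-cong K (λ r → trans (*-congʳ (*-congˡ (1^n≈1 (r ℕ.+ r))))
               (trans (solve 3 (λ s Q R → s :* con (+ 1) :* (con (+ 1) :* (con (+ 1) :- Q :* con (+ 1) :* R)) := s :- s :* (Q :* R))
                 refl (s r * q ^ r) q ((q ^ r) ^ 2))
               (+-cong (s*q^r r) (trans (-‿cong (s-mirror′ r)) (-‿involutive _))))) ⟩
        Σ< K (λ r → poch₂ 0# (q ^ 4) (q ^ 5) r + poch₂ 0# q (q ^ 5) (suc r))
          ≈⟨ jacobi-triple-product (q∣q^suc 4) v-inv (*-comm _ _) (q∣q^suc 3) ∣ʳ-refl 0<M ⟨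
        poch (q ^ 5) (q ^ 5) K * poch (q ^ 4) (q ^ 5) K * poch q (q ^ 5) K ∎

-- The double sums: recurrence in k and comparison with Rogers' series.

module DoubleSum {c ℓ} (R : CommutativeRing c ℓ) where

  open import Data.Product.Base using (_×_)
  open CommutativeRing R
  open IntegerSolver R
  open FiniteSums R
  open QSeries R
  open Theta R
  open import Relation.Binary.Reasoning.Setoid setoid

  T : ℕ → ℕ
  T m = ⌊ m ℕ.* (3 ℕ.* m ℕ.+ 1) /2⌋

  ⌊a+b+b/2⌋ : ∀ a b → ⌊ a ℕ.+ (b ℕ.+ b) /2⌋ ≡ ⌊ a /2⌋ ℕ.+ b
  ⌊a+b+b/2⌋ a zero rewrite ℕ.+-identityʳ a = ≡.sym (ℕ.+-identityʳ _)
  ⌊a+b+b/2⌋ a (suc b) rewrite ℕ.+-suc b b | ℕ.+-suc a (suc (b ℕ.+ b)) | ℕ.+-suc a (b ℕ.+ b) | ℕ.+-suc ⌊ a /2⌋ b =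
    ≡.cong suc (⌊a+b+b/2⌋ a b)

  T-suc : ∀ m → T (suc m) ≡ T m ℕ.+ (3 ℕ.* m ℕ.+ 2)
  T-suc m = ≡.trans (≡.cong ⌊_/2⌋ (lem m)) (⌊a+b+b/2⌋ (m ℕ.* (3 ℕ.* m ℕ.+ 1)) (3 ℕ.* m ℕ.+ 2))
    where
    lem : ∀ m → suc m ℕ.* (3 ℕ.* suc m ℕ.+ 1) ≡ m ℕ.* (3 ℕ.* m ℕ.+ 1) ℕ.+ ((3 ℕ.* m ℕ.+ 2) ℕ.+ (3 ℕ.* m ℕ.+ 2))
    lem = solve-∀

  m≤T : ∀ m → m ≤ T m
  m≤T zero    = z≤n
  m≤T (suc m) = ℕ.≤-trans (ℕ.≤-reflexive (ℕ.+-comm 1 m)) (ℕ.≤-trans (ℕ.+-mono-≤ (m≤T m) (ℕ.≤-trans (s≤s z≤n) (ℕ.m≤n+m 2 (3 ℕ.* m))))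
    (ℕ.≤-reflexive (≡.sym (T-suc m))))

  E : ℕ → ℕ → ℕ → ℕ
  E k m n = T m ℕ.+ 4 ℕ.* m ℕ.* n ℕ.+ 4 ℕ.* n ℕ.* n ℕ.+ k ℕ.* (m ℕ.+ 2 ℕ.* n)

  m≤E : ∀ k m n → m ≤ E k m n
  m≤E k m n = ℕ.≤-trans (m≤T m) (ℕ.≤-trans (ℕ.m≤m+n _ _) (ℕ.≤-trans (ℕ.m≤m+n _ (4 ℕ.* n ℕ.* n)) (ℕ.m≤m+n _ _)))

  n≤E : ∀ k m n → n ≤ E k m n
  n≤E k m n = ℕ.≤-trans (n≤4nn n) (ℕ.≤-trans (ℕ.m≤n+m _ (T m ℕ.+ 4 ℕ.* m ℕ.* n)) (ℕ.m≤m+n _ _))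
    where
    n≤4nn : ∀ n → n ≤ 4 ℕ.* n ℕ.* n
    n≤4nn zero    = z≤n
    n≤4nn (suc n) = ℕ.m≤n*m (suc n) (4 ℕ.* suc n)

  k[m+2n]≤E : ∀ k m n → k ℕ.* (m ℕ.+ 2 ℕ.* n) ≤ E k m n
  k[m+2n]≤E k m n = ℕ.m≤n+m _ _

  E-suc-k : ∀ k m n → E (suc k) m n ≡ E k m n ℕ.+ (m ℕ.+ 2 ℕ.* n)
  E-suc-k k m n = lem (T m) k m n
    where
    lem : ∀ t k m n → t ℕ.+ 4 ℕ.* m ℕ.* n ℕ.+ 4 ℕ.* n ℕ.* n ℕ.+ suc k ℕ.* (m ℕ.+ 2 ℕ.* n)
       ≡ t ℕ.+ 4 ℕ.* m ℕ.* n ℕ.+ 4 ℕ.* n ℕ.* n ℕ.+ k ℕ.* (m ℕ.+ 2 ℕ.* n) ℕ.+ (m ℕ.+ 2 ℕ.* n)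
    lem = solve-∀

  -- The increment is 4(m+2n) plus a constant. The quadratic form was inserted with weight m + 2n
  -- precisely so that such increments are absorbed by a change of k.
  E-suc-n : ∀ k m n → E k m (suc n) ≡ (4 ℕ.+ 2 ℕ.* k) ℕ.+ E (4 ℕ.+ k) m n
  E-suc-n k m n = lem (T m) k m n
    where
    lem : ∀ t k m n → t ℕ.+ 4 ℕ.* m ℕ.* suc n ℕ.+ 4 ℕ.* suc n ℕ.* suc n ℕ.+ k ℕ.* (m ℕ.+ 2 ℕ.* suc n)
       ≡ 4 ℕ.+ 2 ℕ.* k ℕ.+ (t ℕ.+ 4 ℕ.* m ℕ.* n ℕ.+ 4 ℕ.* n ℕ.* n ℕ.+ (4 ℕ.+ k) ℕ.* (m ℕ.+ 2 ℕ.* n))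
    lem = solve-∀

  -- The increment 3m + 4n alone is not a multiple of m + 2n. The added 2n, supplied by the factor
  -- q^(2n) in `d-diff`, completes it to 3(m+2n).
  E-suc-m : ∀ k m n → E k (suc m) n ℕ.+ 2 ℕ.* n ≡ (2 ℕ.+ k) ℕ.+ E (3 ℕ.+ k) m n
  E-suc-m k m n rewrite T-suc m = lem (T m) k m n
    where
    lem : ∀ t k m n → t ℕ.+ (3 ℕ.* m ℕ.+ 2) ℕ.+ 4 ℕ.* suc m ℕ.* n ℕ.+ 4 ℕ.* n ℕ.* n ℕ.+ k ℕ.* (suc m ℕ.+ 2 ℕ.* n) ℕ.+ 2 ℕ.* n
       ≡ 2 ℕ.+ k ℕ.+ (t ℕ.+ 4 ℕ.* m ℕ.* n ℕ.+ 4 ℕ.* n ℕ.* n ℕ.+ (3 ℕ.+ k) ℕ.* (m ℕ.+ 2 ℕ.* n))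
    lem = solve-∀

  module _ (q : Carrier) (M : ℕ) (q^M≈0 : q ^ M ≈ 0#) (0<M : 0 < M)
           {i j : ℕ → Carrier}
           (i-inv : ∀ m → i m * poch q q m ≈ 1#)
           (j-inv : ∀ n → j n * poch (q ^ 2) (q ^ 2) n ≈ 1#) where
    open Nilpotent q M q^M≈0

    private
      i-step : ∀ m → i (suc m) * (1# - q ^ suc m) ≈ i m
      i-step = reciprocal-step i-inv

      j-step : ∀ n → j (suc n) * (1# - q ^ (2 ℕ.* suc n)) ≈ j n
      j-step n = trans (*-congˡ (+-congˡ (-‿cong (sym (^-assocʳ q 2 (suc n)))))) (reciprocal-step j-inv n)

      d : ℕ → ℕ → ℕ → Carrier
      d k m n = q ^ E k m n * i m * j n

      d-vanish : ∀ k m n → M ≤ E k m n → d k m n ≈ 0#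
      d-vanish k m n M≤ = trans (*-congʳ (trans (*-congʳ (q^-vanish M≤)) (zeroˡ _))) (zeroˡ _)

      D : ℕ → Carrier
      D k = Σ< M λ m → Σ< M λ n → d k m n

      d-diff : ∀ k m n → d k m n - d (suc k) m n
        ≈ d k m n * (1# - q ^ (2 ℕ.* n)) + d k m n * q ^ (2 ℕ.* n) * (1# - q ^ m)
      d-diff k m n = begin
        d k m n - d (suc k) m n
          ≈⟨ +-congˡ (-‿cong (*-congʳ (*-congʳ (trans (^-split q (E k m n) (m ℕ.+ 2 ℕ.* n) (E-suc-k k m n)) (*-congˡ (^-homo-* q m (2 ℕ.* n))))))) ⟩
        Q * i m * j n - Q * (q ^ m * q ^ (2 ℕ.* n)) * i m * j n
          ≈⟨ solve 5 (λ Q a b i j → Q :* i :* j :- Q :* (a :* b) :* i :* j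
               := Q :* i :* j :* (con (+ 1) :- b) :+ Q :* i :* j :* b :* (con (+ 1) :- a)) refl Q (q ^ m) (q ^ (2 ℕ.* n)) (i m) (j n) ⟩
        d k m n * (1# - q ^ (2 ℕ.* n)) + d k m n * q ^ (2 ℕ.* n) * (1# - q ^ m) ∎
        where
        Q : Carrier
        Q = q ^ E k m n

      D-n-part : ∀ k → Σ< M (λ m → Σ< M λ n → d k m n * (1# - q ^ (2 ℕ.* n))) ≈ q ^ (4 ℕ.+ 2 ℕ.* k) * D (4 ℕ.+ k)
      D-n-part k = trans (Σ-cong M λ m → trans
          (Σ-shift M (trans (*-congˡ (-‿inverseʳ 1#)) (zeroʳ _)) (trans (*-congʳ (d-vanish k m M (n≤E k m M))) (zeroˡ _)))
          (trans (Σ-cong M λ n → term m n) (sym (Σ-*ˡ _ M))))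
        (sym (Σ-*ˡ _ M))
        where
        term : ∀ m n → d k m (suc n) * (1# - q ^ (2 ℕ.* suc n)) ≈ q ^ (4 ℕ.+ 2 ℕ.* k) * d (4 ℕ.+ k) m n
        term m n = trans (*-assoc _ _ _) (trans (*-cong (*-congʳ (^-split q (4 ℕ.+ 2 ℕ.* k) (E (4 ℕ.+ k) m n) (E-suc-n k m n))) (j-step n))
          (solve 4 (λ a b i j → a :* b :* i :* j := a :* (b :* i :* j)) refl (q ^ (4 ℕ.+ 2 ℕ.* k)) _ _ _))

      D-m-part : ∀ k → Σ< M (λ m → Σ< M λ n → d k m n * q ^ (2 ℕ.* n) * (1# - q ^ m)) ≈ q ^ (2 ℕ.+ k) * D (3 ℕ.+ k)
      D-m-part k = trans
        (Σ-shift M (Σ-zero M λ n → trans (*-congˡ (-‿inverseʳ 1#)) (zeroʳ _))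
          (Σ-zero M λ n → trans (*-congʳ (trans (*-congʳ (d-vanish k M n (m≤E k M n))) (zeroˡ _))) (zeroˡ _)))
        (trans (Σ-cong M λ m → trans (Σ-cong M λ n → term m n) (sym (Σ-*ˡ _ M))) (sym (Σ-*ˡ _ M)))
        where
        term : ∀ m n → d k (suc m) n * q ^ (2 ℕ.* n) * (1# - q ^ suc m) ≈ q ^ (2 ℕ.+ k) * d (3 ℕ.+ k) m n
        term m n = begin
          q ^ E k (suc m) n * i (suc m) * j n * q ^ (2 ℕ.* n) * (1# - q ^ suc m)
            ≈⟨ solve 5 (λ Q i j b a → Q :* i :* j :* b :* a := Q :* b :* (i :* a) :* j) refl _ _ _ _ _ ⟩
          q ^ E k (suc m) n * q ^ (2 ℕ.* n) * (i (suc m) * (1# - q ^ suc m)) * j n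
            ≈⟨ *-congʳ (*-cong (trans (sym (^-homo-* q (E k (suc m) n) (2 ℕ.* n))) (^-split q (2 ℕ.+ k) (E (3 ℕ.+ k) m n) (E-suc-m k m n))) (i-step m)) ⟩
          q ^ (2 ℕ.+ k) * q ^ E (3 ℕ.+ k) m n * i m * j n
            ≈⟨ solve 4 (λ a b i j → a :* b :* i :* j := a :* (b :* i :* j)) refl (q ^ (2 ℕ.+ k)) _ _ _ ⟩
          q ^ (2 ℕ.+ k) * d (3 ℕ.+ k) m n ∎

      -- 1 - q^(m+2n) = (1 - q^(2n)) + q^(2n) (1 - q^m), and each part cancels a factor of a denominator.
      D-recurrence : ∀ k → D k ≈ D (suc k) + (q ^ (4 ℕ.+ 2 ℕ.* k) * D (4 ℕ.+ k) + q ^ (2 ℕ.+ k) * D (3 ℕ.+ k))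
      D-recurrence k = begin
        D k
          ≈⟨ solve 2 (λ a b → a := b :+ (a :- b)) refl (D k) (D (suc k)) ⟩
        D (suc k) + (D k - D (suc k))
          ≈⟨ +-congˡ (trans (Σ-- M) (Σ-cong M λ m → trans (Σ-- M) (trans (Σ-cong M λ n → d-diff k m n) (Σ-+ M)))) ⟩
        D (suc k) + Σ< M (λ m → Σ< M (λ n → d k m n * (1# - q ^ (2 ℕ.* n))) + Σ< M (λ n → d k m n * q ^ (2 ℕ.* n) * (1# - q ^ m)))
          ≈⟨ +-congˡ (trans (Σ-+ M) (+-cong (D-n-part k) (D-m-part k))) ⟩
        D (suc k) + (q ^ (4 ℕ.+ 2 ℕ.* k) * D (4 ℕ.+ k) + q ^ (2 ℕ.+ k) * D (3 ℕ.+ k)) ∎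

      D-limit : ∀ k → M ≤ k → D k ≈ 1#
      D-limit k M≤k = begin
        D k                ≈⟨ Σ-only-head M 0<M (λ m → Σ-zero M λ n → d-vanish k (suc m) n (large (suc m) n (s≤s z≤n))) ⟩
        Σ< M (d k 0)       ≈⟨ Σ-only-head M 0<M (λ n → d-vanish k 0 (suc n) (large 0 (suc n) (s≤s z≤n))) ⟩
        d k 0 0            ≈⟨ *-cong (*-cong (^-congʳ q (ℕ.*-zeroʳ k)) (trans (sym (*-identityʳ _)) (i-inv 0))) (trans (sym (*-identityʳ _)) (j-inv 0)) ⟩
        1# * 1# * 1#       ≈⟨ trans (*-identityʳ _) (*-identityʳ _) ⟩
        1#                 ∎
        where
        large : ∀ m n → 1 ≤ m ℕ.+ 2 ℕ.* n → M ≤ E k m n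
        large m n 1≤ = ℕ.≤-trans M≤k (ℕ.≤-trans (ℕ.≤-reflexive (≡.sym (ℕ.*-identityʳ k)))
          (ℕ.≤-trans (ℕ.*-monoʳ-≤ k 1≤) (k[m+2n]≤E k m n)))

      H : ℕ → Carrier
      H k = D k + q ^ suc k * D (2 ℕ.+ k)

      -- Since q^(2k+4) = q^(k+1) q^(k+3), the last term of the recurrence for D joins the term
      -- q^(k+1) D_(k+2) of H_k to form q^(k+1) H_(k+2); the other two terms form H_(k+1).
      H-recurrence : ∀ k → H k ≈ H (suc k) + q ^ suc k * H (2 ℕ.+ k)
      H-recurrence k = begin
        D k + q ^ suc k * D (2 ℕ.+ k)
          ≈⟨ +-congʳ (trans (D-recurrence k) (+-congˡ (+-congʳ (*-congʳ (^-split q (suc k) (3 ℕ.+ k) (lem k)))))) ⟩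
        D (suc k) + (q ^ suc k * q ^ (3 ℕ.+ k) * D (4 ℕ.+ k) + q ^ (2 ℕ.+ k) * D (3 ℕ.+ k)) + q ^ suc k * D (2 ℕ.+ k)
          ≈⟨ solve 7 (λ a b c d Q Q₂ Q₃ → a :+ (Q :* Q₃ :* d :+ Q₂ :* c) :+ Q :* b := a :+ Q₂ :* c :+ Q :* (b :+ Q₃ :* d))
               refl (D (suc k)) (D (2 ℕ.+ k)) (D (3 ℕ.+ k)) (D (4 ℕ.+ k)) (q ^ suc k) (q ^ (2 ℕ.+ k)) (q ^ (3 ℕ.+ k)) ⟩
        D (suc k) + q ^ (2 ℕ.+ k) * D (3 ℕ.+ k) + q ^ suc k * (D (2 ℕ.+ k) + q ^ (3 ℕ.+ k) * D (4 ℕ.+ k)) ∎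
        where
        lem : ∀ k → 4 ℕ.+ 2 ℕ.* k ≡ suc k ℕ.+ (3 ℕ.+ k)
        lem = solve-∀

      H-limit : ∀ k → M ≤ k → H k ≈ 1#
      H-limit k M≤k = trans (+-cong (D-limit k M≤k) (trans (*-congʳ (q^-vanish (ℕ.≤-trans M≤k (ℕ.n≤1+n k)))) (zeroˡ _))) (+-identityʳ 1#)

      -- Two solutions of the recurrence that agree far out agree everywhere, by descending induction.
      agree-from : ∀ b k → M ≤ b ℕ.+ k →
        (poch q q M * H k ≈ θ q M q^M≈0 0<M k) × (poch q q M * H (suc k) ≈ θ q M q^M≈0 0<M (suc k))
      agree-from zero k M≤k = limit k M≤k , limit (suc k) (ℕ.≤-trans M≤k (ℕ.n≤1+n k))
        where
        limit : ∀ k → M ≤ k → poch q q M * H k ≈ θ q M q^M≈0 0<M k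
        limit k M≤k = trans (*-congˡ (H-limit k M≤k)) (trans (*-identityʳ _) (sym (θ-limit q M q^M≈0 0<M k M≤k)))
      agree-from (suc b) k M≤ with agree-from b (suc k) (ℕ.≤-trans M≤ (ℕ.≤-reflexive (≡.sym (ℕ.+-suc b k))))
      ... | eq₁ , eq₂ = (begin
        P * H k                                          ≈⟨ *-congˡ (H-recurrence k) ⟩
        P * (H (suc k) + q ^ suc k * H (2 ℕ.+ k))        ≈⟨ solve 4 (λ p a b c → p :* (a :+ b :* c) := p :* a :+ b :* (p :* c)) refl P _ (q ^ suc k) _ ⟩
        P * H (suc k) + q ^ suc k * (P * H (2 ℕ.+ k))    ≈⟨ +-cong eq₁ (*-congˡ eq₂) ⟩
        θ′ (suc k) + q ^ suc k * θ′ (2 ℕ.+ k)            ≈⟨ θ-recurrence q M q^M≈0 0<M k ⟨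
        θ′ k                                             ∎) , eq₁
        where
        P = poch q q M
        θ′ = θ q M q^M≈0 0<M

      H-sum : ∀ k → H k ≈ Σ< M λ m → Σ< M λ n → q ^ E k m n * (1# + q ^ (2 ℕ.* m ℕ.+ 4 ℕ.* n ℕ.+ suc k)) * i m * j n
      H-sum k = trans (+-congˡ (trans (Σ-*ˡ _ M) (Σ-cong M λ m → Σ-*ˡ _ M)))
        (trans (sym (Σ-+ M)) (Σ-cong M λ m → trans (sym (Σ-+ M)) (Σ-cong M λ n → term m n)))
        where
        lem : ∀ t k m n → t ℕ.+ (m ℕ.+ 2 ℕ.* n) ℕ.+ (m ℕ.+ 2 ℕ.* n) ≡ t ℕ.+ (2 ℕ.* m ℕ.+ 4 ℕ.* n)
        lem = solve-∀
        term : ∀ m n → d k m n + q ^ suc k * d (2 ℕ.+ k) m n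
          ≈ q ^ E k m n * (1# + q ^ (2 ℕ.* m ℕ.+ 4 ℕ.* n ℕ.+ suc k)) * i m * j n
        term m n = begin
          d k m n + q ^ suc k * d (2 ℕ.+ k) m n
            ≈⟨ +-congˡ (*-congˡ (*-congʳ (*-congʳ (^-split q (E k m n) (2 ℕ.* m ℕ.+ 4 ℕ.* n)
                 (≡.trans (≡.trans (E-suc-k (suc k) m n) (≡.cong (ℕ._+ (m ℕ.+ 2 ℕ.* n)) (E-suc-k k m n))) (lem (E k m n) k m n)))))) ⟩
          d k m n + q ^ suc k * (q ^ E k m n * q ^ (2 ℕ.* m ℕ.+ 4 ℕ.* n) * i m * j n)
            ≈⟨ solve 5 (λ Q s r i j → Q :* i :* j :+ s :* (Q :* r :* i :* j) := Q :* (con (+ 1) :+ r :* s) :* i :* j)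
                 refl (q ^ E k m n) (q ^ suc k) (q ^ (2 ℕ.* m ℕ.+ 4 ℕ.* n)) (i m) (j n) ⟩
          q ^ E k m n * (1# + q ^ (2 ℕ.* m ℕ.+ 4 ℕ.* n) * q ^ suc k) * i m * j n
            ≈⟨ *-congʳ (*-congʳ (*-congˡ (+-congˡ (^-homo-* q (2 ℕ.* m ℕ.+ 4 ℕ.* n) (suc k))))) ⟨
          q ^ E k m n * (1# + q ^ (2 ℕ.* m ℕ.+ 4 ℕ.* n ℕ.+ suc k)) * i m * j n ∎

    double-sum≈θ : ∀ k → poch q q M *
      (Σ< M λ m → Σ< M λ n → q ^ E k m n * (1# + q ^ (2 ℕ.* m ℕ.+ 4 ℕ.* n ℕ.+ suc k)) * i m * j n) ≈ θ q M q^M≈0 0<M k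
    double-sum≈θ k = trans (*-congˡ (sym (H-sum k))) (proj₁ (agree-from M k (ℕ.m≤m+n M k)))

-- The single sums, evaluated as products.

module RightSide {c ℓ} (R : CommutativeRing c ℓ) where

  open CommutativeRing R
  open import Algebra.Properties.Ring ring
  open import Algebra.Properties.Semiring.Divisibility semiring
  open IntegerSolver R
  open FiniteSums R
  open QSeries R
  open import Relation.Binary.Reasoning.Setoid setoid

  -- With `w` for 1/(p²;p²), the first three factors are the Gaussian binomial; `u` stands for
  -- 1/(p;p²), and ε for the parity of j.
  summand : (c d g p² : Carrier) (u w : ℕ → Carrier) → ℕ → ℕ → ℕ → Carrier
  summand c d g p² u w k ε i =
    poch p² p² k * w i * w (k ∸ i) * poch (- c) p² (i ℕ.+ ε) * poch (- d) p² i * u (i ℕ.+ ε) * g ^ (k ∸ i)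

  module _ (q : Carrier) (M : ℕ) (q^M≈0 : q ^ M ≈ 0#) (0<M : 0 < M) where
    open Nilpotent q M q^M≈0

    module _
      {z c d g p p² : Carrier} (q∣z : q ∣ z) (q∣p : q ∣ p)
      (p²≈ : p² ≈ p * p) (d≈cp : d ≈ c * p) (g≈c² : g ≈ c * c)
      {u v w : ℕ → Carrier}
      (u-inv : ∀ k → u k * poch p p² k ≈ 1#)
      (v-inv : ∀ k → v k * poch p p k ≈ 1#)
      (w-inv : ∀ k → w k * poch p² p² k ≈ 1#) where

      term : ℕ → ℕ → ℕ → Carrier
      term j k ε = z ^ j * w k * Σ< (suc k) (summand c d g p² u w k ε)

      single-sum : Carrier
      single-sum = Σ< M λ j → term j ⌊ j /2⌋ (⌈ j /2⌉ ∸ ⌊ j /2⌋)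

      private
        K : ℕ
        K = M ℕ.+ M

        M≤K : M ≤ K
        M≤K = ℕ.m≤m+n M M

        b y : Carrier
        b = z * - c
        y = z * c

        -- The general terms z^n (-c;p)_n / (p;p)_n and (zc)^(2l) / (p²;p²)_l, in the homogeneous
        -- form to which `q-binomial` applies.
        α ζ : ℕ → Carrier
        α n = poch₂ z b p n * v n
        ζ l = poch₂ (y * y) 0# p² l * w l

        -- The interleaving of two products of base p² for a total length of parity ε. It is all
        -- that the even and the odd j differ in, so one argument serves both.
        p-split : ℕ → Set _
        p-split ε = ∀ a i → poch a p (ε ℕ.+ (i ℕ.+ i)) ≈ poch a p² (i ℕ.+ ε) * poch (a * p) p² i

        p-split-0 : p-split 0
        p-split-0 a i rewrite ℕ.+-identityʳ i = poch-even a p²≈ i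

        p-split-1 : p-split 1
        p-split-1 a i rewrite ℕ.+-comm i 1 = poch-odd a p²≈ i

        module _ {ε : ℕ} (split : p-split ε) where

          w*u≈v : ∀ i → w i * u (i ℕ.+ ε) ≈ v (ε ℕ.+ (i ℕ.+ i))
          w*u≈v i = inverse-unique (begin
            w i * u (i ℕ.+ ε) * poch p p (ε ℕ.+ (i ℕ.+ i))
              ≈⟨ *-congˡ (trans (split p i) (*-congˡ (poch-cong (sym p²≈) refl i))) ⟩
            w i * u (i ℕ.+ ε) * (poch p p² (i ℕ.+ ε) * poch p² p² i)
              ≈⟨ solve 4 (λ a b c d → a :* b :* (c :* d) := a :* d :* (b :* c)) refl _ _ _ _ ⟩
            w i * poch p² p² i * (u (i ℕ.+ ε) * poch p p² (i ℕ.+ ε))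
              ≈⟨ *-cong (w-inv i) (u-inv (i ℕ.+ ε)) ⟩
            1# * 1#
              ≈⟨ *-identityʳ 1# ⟩
            1# ∎) (v-inv _)

          -- Of the 2k + ε factors z, 2(k-i) pair off with g = c² to give (zc)²; the remaining 2i +
          -- ε belong to the other series.
          powers : ∀ {k i} → i ≤ k → z ^ (ε ℕ.+ (k ℕ.+ k)) * g ^ (k ∸ i) ≈ z ^ (ε ℕ.+ (i ℕ.+ i)) * (y * y) ^ (k ∸ i)
          powers {k} {i} i≤k = begin
            z ^ (ε ℕ.+ (k ℕ.+ k)) * g ^ l
              ≈⟨ *-cong (trans (^-split z (ε ℕ.+ (i ℕ.+ i)) (l ℕ.+ l) exponent) (*-congˡ (^-double refl l))) (^-congˡ l g≈c²) ⟩
            z ^ (ε ℕ.+ (i ℕ.+ i)) * (z * z) ^ l * (c * c) ^ l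
              ≈⟨ *-assoc _ _ _ ⟩
            z ^ (ε ℕ.+ (i ℕ.+ i)) * ((z * z) ^ l * (c * c) ^ l)
              ≈⟨ *-congˡ (trans (sym (^-distrib-* (z * z) (c * c) l)) (^-congˡ l (solve 2 (λ z c → z :* z :* (c :* c) := z :* c :* (z :* c)) refl z c))) ⟩
            z ^ (ε ℕ.+ (i ℕ.+ i)) * (y * y) ^ l ∎
            where
            l : ℕ
            l = k ∸ i
            lem : ∀ ε i l → ε ℕ.+ ((i ℕ.+ l) ℕ.+ (i ℕ.+ l)) ≡ ε ℕ.+ (i ℕ.+ i) ℕ.+ (l ℕ.+ l)
            lem = solve-∀
            exponent : ε ℕ.+ (k ℕ.+ k) ≡ ε ℕ.+ (i ℕ.+ i) ℕ.+ (l ℕ.+ l)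
            exponent = ≡.trans (≡.cong (λ n → ε ℕ.+ (n ℕ.+ n)) (≡.sym (ℕ.m+[n∸m]≡n i≤k))) (lem ε i l)

          -- The outer 1/(p²;p²)_k cancels the numerator of the Gaussian binomial, after which the
          -- dependence on i and on k - i separates.
          term≈convolution : ∀ k → term (ε ℕ.+ (k ℕ.+ k)) k ε ≈ Σ< (suc k) λ i → α (ε ℕ.+ (i ℕ.+ i)) * ζ (k ∸ i)
          term≈convolution k = trans (Σ-*ˡ _ (suc k)) (Σ-cong< (suc k) λ i i<1+k → convolve i (ℕ.s≤s⁻¹ i<1+k))
            where
            convolve : ∀ i → i ≤ k → z ^ (ε ℕ.+ (k ℕ.+ k)) * w k * summand c d g p² u w k ε i
              ≈ α (ε ℕ.+ (i ℕ.+ i)) * ζ (k ∸ i)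
            convolve i i≤k = begin
              Z * w k * (poch p² p² k * w i * w l * A * B * u (i ℕ.+ ε) * g ^ l)
                ≈⟨ solve 9 (λ Z wk P wi wl A B u G → Z :* wk :* (P :* wi :* wl :* A :* B :* u :* G)
                     := wk :* P :* (Z :* G) :* (A :* B) :* (wi :* u) :* wl) refl _ _ _ _ _ _ _ _ _ ⟩
              w k * poch p² p² k * (Z * g ^ l) * (A * B) * (w i * u (i ℕ.+ ε)) * w l
                ≈⟨ *-congʳ (*-cong (*-cong (*-cong (w-inv k) (powers i≤k))
                     (trans (*-congˡ (poch-cong (trans (-‿cong d≈cp) (-‿distribˡ-* c p)) refl i)) (sym (split (- c) i)))) (w*u≈v i)) ⟩
              1# * (z ^ n * (y * y) ^ l) * poch (- c) p n * v n * w l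
                ≈⟨ solve 5 (λ a b A v w → con (+ 1) :* (a :* b) :* A :* v :* w := a :* A :* v :* (b :* w)) refl _ _ _ _ _ ⟩
              z ^ n * poch (- c) p n * v n * ((y * y) ^ l * w l)
                ≈⟨ *-cong (*-congʳ (poch₂-scale z (- c) p n)) (*-congʳ (poch₂-0ʳ (y * y) p² l)) ⟨
              α n * ζ l ∎
              where
              l n : ℕ
              l = k ∸ i
              n = ε ℕ.+ (i ℕ.+ i)
              Z A B : Carrier
              Z = z ^ (ε ℕ.+ (k ℕ.+ k))
              A = poch (- c) p² (i ℕ.+ ε)
              B = poch (- d) p² i

        even-term : ∀ k → term (k ℕ.+ k) ⌊ k ℕ.+ k /2⌋ (⌈ k ℕ.+ k /2⌉ ∸ ⌊ k ℕ.+ k /2⌋) ≡ term (k ℕ.+ k) k 0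
        even-term k = ≡.cong₂ (term (k ℕ.+ k)) (≡.sym (ℕ.n≡⌊n+n/2⌋ k))
          (≡.trans (≡.cong₂ _∸_ (≡.sym (ℕ.n≡⌈n+n/2⌉ k)) (≡.sym (ℕ.n≡⌊n+n/2⌋ k))) (ℕ.n∸n≡0 k))

        odd-term : ∀ k → term (suc (k ℕ.+ k)) ⌊ suc (k ℕ.+ k) /2⌋ (⌈ suc (k ℕ.+ k) /2⌉ ∸ ⌊ suc (k ℕ.+ k) /2⌋) ≡ term (suc (k ℕ.+ k)) k 1
        odd-term k = ≡.cong₂ (term (suc (k ℕ.+ k))) (≡.sym (ℕ.n≡⌈n+n/2⌉ k))
          (≡.trans (≡.cong₂ _∸_ (≡.cong suc (≡.sym (ℕ.n≡⌊n+n/2⌋ k))) (≡.sym (ℕ.n≡⌈n+n/2⌉ k))) (ℕ.m+n∸n≡m 1 k))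

        q∣b : q ∣ b
        q∣b = ∣-*ˡ _ q∣z

        q∣y : q ∣ y
        q∣y = ∣-*ˡ _ q∣z

        q∣p² : q ∣ p²
        q∣p² = ∣ʳ-respʳ-≈ (sym p²≈) (∣-*ˡ p q∣p)

        ∣-α : ∀ n → q ^ n ∣ α n
        ∣-α n = ∣-*ˡ (v n) (∣-poch₂ p q∣z q∣b n)

        ∣-α₂ : ∀ i → q ^ i ∣ α (i ℕ.+ i) + α (suc (i ℕ.+ i))
        ∣-α₂ i = ∣-+ (weaken (∣-α (i ℕ.+ i))) (weaken (∣ʳ-trans (x∣ʳyx (q ^ (i ℕ.+ i)) q) (∣-α (suc (i ℕ.+ i)))))
          where
          weaken : ∀ {x} → q ^ (i ℕ.+ i) ∣ x → q ^ i ∣ x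
          weaken = ∣ʳ-trans (∣ʳ-respʳ-≈ (sym (^-homo-* q i i)) (x∣ʳyx (q ^ i) (q ^ i)))

        ∣-ζ : ∀ l → q ^ l ∣ ζ l
        ∣-ζ l = ∣-*ˡ (w l) (∣-poch₂ p² (∣-*ˡ y q∣y) (q ∣0) l)

      single-sum≈product : single-sum ≈ Σ< K α * Σ< M ζ
      single-sum≈product = begin
        single-sum
          -- Terms with j ≥ M vanish because q divides z; the even length 2M lets j run in pairs 2k,
          -- 2k + 1.
          ≈⟨ Σ-extend M M (λ j M≤j → trans (*-assoc _ _ _) (trans (*-congʳ (^-vanish q∣z M≤j)) (zeroˡ _))) ⟨
        Σ< K (λ j → term j ⌊ j /2⌋ (⌈ j /2⌉ ∸ ⌊ j /2⌋))
          ≈⟨ Σ-pairs M ⟩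
        Σ< M _
          ≈⟨ Σ-cong M (λ k → trans (+-cong
               (trans (reflexive (even-term k)) (term≈convolution p-split-0 k))
               (trans (reflexive (odd-term k)) (term≈convolution p-split-1 k)))
               (trans (sym (Σ-+ (suc k))) (Σ-cong (suc k) λ i → sym (distribʳ _ _ _)))) ⟩
        Σ< M (λ k → Σ< (suc k) (λ i → (α (i ℕ.+ i) + α (suc (i ℕ.+ i))) * ζ (k ∸ i)))
          ≈⟨ Σ-triangle M (λ i l → (α (i ℕ.+ i) + α (suc (i ℕ.+ i))) * ζ l) (λ i l M≤ → vanish M≤ (∣-*-+ i l (∣-α₂ i) (∣-ζ l))) ⟩
        Σ< M (λ i → Σ< M (λ l → (α (i ℕ.+ i) + α (suc (i ℕ.+ i))) * ζ l))
          ≈⟨ Σ-cong M (λ i → sym (Σ-*ˡ _ M)) ⟩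
        Σ< M (λ i → (α (i ℕ.+ i) + α (suc (i ℕ.+ i))) * Σ< M ζ)
          ≈⟨ Σ-*ʳ _ M ⟨
        Σ< M (λ i → α (i ℕ.+ i) + α (suc (i ℕ.+ i))) * Σ< M ζ
          ≈⟨ *-congʳ (Σ-pairs M) ⟨
        Σ< K α * Σ< M ζ ∎

      single-sum-product : poch z p K * poch (z * c) p K * single-sum ≈ 1#
      -- The auxiliary factor (-y;p) completes (y;p) to (y²;p²), which clears the sum of `ζ`. It is
      -- also what the sum of `α` leaves behind, since b = -y.
      single-sum-product = unipotent-cancelˡ (unipotent-poch p (∣-neg q∣y) K) (begin
        poch (- y) p K * (poch z p K * poch y p K * single-sum)
          ≈⟨ *-congˡ (*-congˡ single-sum≈product) ⟩
        poch (- y) p K * (poch z p K * poch y p K * (Σ< K α * Σ< M ζ))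
          ≈⟨ solve 5 (λ a b c d e → a :* (b :* c :* (d :* e)) := b :* d :* (c :* a :* e)) refl _ _ _ _ _ ⟩
        poch z p K * Σ< K α * (poch y p K * poch (- y) p K * Σ< M ζ)
          ≈⟨ *-cong (q-binomial q∣p v-inv q∣z q∣b K K M≤K M≤K (ℕ.≤-trans 0<M M≤K)) (*-congʳ (sym (poch-± y p²≈ K))) ⟩
        poch b p K * (poch (y * y) p² K * Σ< M ζ)
          ≈⟨ *-cong (poch-cong (sym (-‿distribʳ-* z c)) refl K)
               (trans (q-binomial q∣p² w-inv (∣-*ˡ y q∣y) (q ∣0) K M M≤K ℕ.≤-refl 0<M) (poch-0# p² K)) ⟩
        poch (- y) p K * 1# ∎)

-- Both identities in a ring with nilpotent q.

module RogersRamanujan {c ℓ} (R : CommutativeRing c ℓ) where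

  open CommutativeRing R
  open import Algebra.Properties.Semiring.Divisibility semiring
  open IntegerSolver R
  open FiniteSums R
  open QSeries R
  open Theta R
  open DoubleSum R
  open RightSide R
  open import Relation.Binary.Reasoning.Setoid setoid

  module Identities (q : Carrier) (M : ℕ) (q^M≈0 : q ^ M ≈ 0#) (0<M : 0 < M)
           (i j u v w : ℕ → Carrier)
           (i-inv : ∀ k → i k * poch q q k ≈ 1#)
           (j-inv : ∀ k → j k * poch (q ^ 2) (q ^ 2) k ≈ 1#)
           (u-inv : ∀ k → u k * poch (q ^ 5) (q ^ 10) k ≈ 1#)
           (v-inv : ∀ k → v k * poch (q ^ 5) (q ^ 5) k ≈ 1#)
           (w-inv : ∀ k → w k * poch (q ^ 10) (q ^ 10) k ≈ 1#) where
    open Nilpotent q M q^M≈0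

    private
      K : ℕ
      K = M ℕ.+ M

      A : ℕ → Carrier
      A a = poch (q ^ a) (q ^ 5) K

      euler-product : poch q q M ≈ poch q (q ^ 5) K * A 2 * A 3 * A 4 * A 5
      euler-product = trans (sym (poch-stable q ∣ʳ-refl ℕ.≤-refl (ℕ.≤-trans (ℕ.m≤m+n M M) (ℕ.m≤m*n K 5)))) (poch-mod5 q K)

      -- Multiplied by the Euler product B C, both X and Y become C. In the applications C is the
      -- triple product, and B collects the two remaining residue classes modulo 5.
      via-product : ∀ {X Y B C} → poch q q M * X ≈ C → poch q q M ≈ B * C → B * Y ≈ 1# → X ≈ Y
      via-product {X} {Y} {B} {C} EX≈C E≈BC BY≈1 = unipotent-cancelˡ (unipotent-poch q ∣ʳ-refl M) (begin
        poch q q M * X    ≈⟨ EX≈C ⟩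
        C                 ≈⟨ *-identityʳ C ⟨
        C * 1#            ≈⟨ *-congˡ BY≈1 ⟨
        C * (B * Y)       ≈⟨ solve 3 (λ b c y → c :* (b :* y) := b :* c :* y) refl B C Y ⟩
        B * C * Y         ≈⟨ *-congʳ E≈BC ⟨
        poch q q M * Y    ∎)

    double-sum : ℕ → Carrier
    double-sum k = Σ< M λ m → Σ< M λ n → q ^ E k m n * (1# + q ^ (2 ℕ.* m ℕ.+ 4 ℕ.* n ℕ.+ suc k)) * i m * j n

    single-sum₀ single-sum₁ : Carrier
    single-sum₀ = single-sum q M q^M≈0 0<M {q} {q ^ 3} {q ^ 8} {q ^ 6} {q ^ 5} {q ^ 10}
      ∣ʳ-refl (q∣q^suc 4) (^-homo-* q 5 5) (^-homo-* q 3 5) (^-homo-* q 3 3) u-inv v-inv w-inv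
    single-sum₁ = single-sum q M q^M≈0 0<M {q ^ 2} {q} {q ^ 6} {q ^ 2} {q ^ 5} {q ^ 10}
      (q∣q^suc 1) (q∣q^suc 4) (^-homo-* q 5 5) refl (*-congˡ (*-identityʳ q)) u-inv v-inv w-inv

    first-identity : double-sum 0 ≈ single-sum₀
    first-identity = via-product
      (trans (double-sum≈θ q M q^M≈0 0<M i-inv j-inv 0) (θ₀-product q M q^M≈0 0<M v-inv))
      (trans euler-product (solve 5 (λ a b c d e → a :* b :* c :* d :* e := a :* d :* (e :* c :* b)) refl _ _ _ _ _))
      (single-sum-product q M q^M≈0 0<M ∣ʳ-refl (q∣q^suc 4) (^-homo-* q 5 5) (^-homo-* q 3 5) (^-homo-* q 3 3) u-inv v-inv w-inv)

    second-identity : double-sum 1 ≈ single-sum₁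
    second-identity = via-product
      (trans (double-sum≈θ q M q^M≈0 0<M i-inv j-inv 1) (θ₁-product q M q^M≈0 0<M v-inv))
      (trans euler-product (trans
        (*-congʳ (*-congʳ (*-congˡ (poch-cong (*-comm q (q ^ 2)) refl K))))
        (solve 5 (λ a b c d e → a :* b :* c :* d :* e := b :* c :* (e :* d :* a)) refl _ _ _ _ _)))
      (single-sum-product q M q^M≈0 0<M (q∣q^suc 1) (q∣q^suc 4) (^-homo-* q 5 5) refl (*-congˡ (*-identityʳ q)) u-inv v-inv w-inv)

  double-summand-cong : ∀ a a′ b b′ x y → a ≈ a′ → b ≈ b′ → a * (1# + b) * x * y ≈ a′ * (1# + b′) * x * y
  double-summand-cong a a′ b b′ x y a≈ b≈ = *-congʳ (*-congʳ (*-cong a≈ (+-congˡ b≈)))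

  inner-summand-cong : ∀ a a′ x y b b′ c c′ z d d′ → a ≈ a′ → b ≈ b′ → c ≈ c′ → d ≈ d′ →
    a * x * y * b * c * z * d ≈ a′ * x * y * b′ * c′ * z * d′
  inner-summand-cong a a′ x y b b′ c c′ z d d′ a≈ b≈ c≈ d≈ =
    *-cong (*-congʳ (*-cong (*-cong (*-congʳ (*-congʳ a≈)) b≈) c≈)) d≈

  outer-summand-cong : ∀ a a′ x b b′ → a ≈ a′ → b ≈ b′ → a * x * b ≈ a′ * x * b′
  outer-summand-cong a a′ x b b′ a≈ b≈ = *-cong (*-congʳ a≈) b≈

open import Defs

-- Integer power series modulo q^M as a commutative ring.

module PowerSeries where

  open ≡ using (cong; cong₂; refl; sym; trans)
  open FiniteSums ℤ.+-*-commutativeRing renaming (Σ< to Σℤ)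
  open +-*-Solver using (solve; _:=_; _:+_; _:*_; con)
  open ≡.≡-Reasoning

  sumℤ≡Σℤ : ∀ n f → sumℤ n f ≡ Σℤ (suc n) f
  sumℤ≡Σℤ zero    f = sym (ℤ.+-identityˡ (f 0))
  sumℤ≡Σℤ (suc n) f = cong (ℤ._+ f (suc n)) (sumℤ≡Σℤ n f)

  *ₚ-def : ∀ f g n → (f *ₚ g) n ≡ Σℤ (suc n) (λ k → f k ℤ.* g (n ∸ k))
  *ₚ-def f g n = sumℤ≡Σℤ n _

  -- Writing f as f 0 plus q times its tail makes the product recursive in the left factor.
  -- Associativity then follows by induction, without rearranging a double sum.
  *ₚ-suc : ∀ f g n → (f *ₚ g) (suc n) ≡ f 0 ℤ.* g (suc n) ℤ.+ ((f ∘ suc) *ₚ g) n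
  *ₚ-suc f g n = trans (*ₚ-def f g (suc n)) (trans (Σ-head (suc n)) (cong (ℤ._+_ (f 0 ℤ.* g (suc n))) (sym (*ₚ-def (f ∘ suc) g n))))

  *ₚ-cong< : ∀ {f f′ g g′} n → (∀ k → k ≤ n → f k ≡ f′ k) → (∀ k → k ≤ n → g k ≡ g′ k) → (f *ₚ g) n ≡ (f′ *ₚ g′) n
  *ₚ-cong< {f} {f′} {g} {g′} n f≡ g≡ = trans (*ₚ-def f g n) (trans
    (Σ-cong< (suc n) λ k k<1+n → cong₂ ℤ._*_ (f≡ k (ℕ.s≤s⁻¹ k<1+n)) (g≡ (n ∸ k) (ℕ.m∸n≤m n k)))
    (sym (*ₚ-def f′ g′ n)))

  *ₚ-cong : ∀ {f f′ g g′} → f ≗ f′ → g ≗ g′ → f *ₚ g ≗ f′ *ₚ g′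
  *ₚ-cong {f} {f′} {g} {g′} f≗ g≗ n = *ₚ-cong< {f} {f′} {g} {g′} n (λ k _ → f≗ k) (λ k _ → g≗ k)

  *ₚ-comm : ∀ f g → f *ₚ g ≗ g *ₚ f
  *ₚ-comm f g n = begin
    (f *ₚ g) n
      ≡⟨ *ₚ-def f g n ⟩
    Σℤ (suc n) (λ k → f k ℤ.* g (n ∸ k))
      ≡⟨ Σ-reverse (suc n) ⟩
    Σℤ (suc n) (λ k → f (n ∸ k) ℤ.* g (n ∸ (n ∸ k)))
      ≡⟨ Σ-cong< (suc n) (λ k k<1+n → trans (ℤ.*-comm (f (n ∸ k)) (g (n ∸ (n ∸ k))))
           (cong (λ i → g i ℤ.* f (n ∸ k)) (ℕ.m∸[m∸n]≡n (ℕ.s≤s⁻¹ k<1+n)))) ⟩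
    Σℤ (suc n) (λ k → g k ℤ.* f (n ∸ k))
      ≡⟨ *ₚ-def g f n ⟨
    (g *ₚ f) n ∎

  *ₚ-distribʳ : ∀ h f g → (f +ₚ g) *ₚ h ≗ f *ₚ h +ₚ g *ₚ h
  *ₚ-distribʳ h f g n = begin
    ((f +ₚ g) *ₚ h) n
      ≡⟨ *ₚ-def (f +ₚ g) h n ⟩
    Σℤ (suc n) (λ k → (f k ℤ.+ g k) ℤ.* h (n ∸ k))
      ≡⟨ Σ-cong (suc n) (λ k → ℤ.*-distribʳ-+ (h (n ∸ k)) (f k) (g k)) ⟩
    Σℤ (suc n) (λ k → f k ℤ.* h (n ∸ k) ℤ.+ g k ℤ.* h (n ∸ k))
      ≡⟨ Σ-+ (suc n) ⟩
    Σℤ (suc n) (λ k → f k ℤ.* h (n ∸ k)) ℤ.+ Σℤ (suc n) (λ k → g k ℤ.* h (n ∸ k))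
      ≡⟨ cong₂ ℤ._+_ (*ₚ-def f h n) (*ₚ-def g h n) ⟨
    (f *ₚ h +ₚ g *ₚ h) n ∎

  *ₚ-scaleˡ : ∀ a f g n → ((λ k → a ℤ.* f k) *ₚ g) n ≡ a ℤ.* (f *ₚ g) n
  *ₚ-scaleˡ a f g n = begin
    ((λ k → a ℤ.* f k) *ₚ g) n                      ≡⟨ *ₚ-def (λ k → a ℤ.* f k) g n ⟩
    Σℤ (suc n) (λ k → a ℤ.* f k ℤ.* g (n ∸ k))      ≡⟨ Σ-cong (suc n) (λ k → ℤ.*-assoc a (f k) (g (n ∸ k))) ⟩
    Σℤ (suc n) (λ k → a ℤ.* (f k ℤ.* g (n ∸ k)))    ≡⟨ Σ-*ˡ a (suc n) ⟨
    a ℤ.* Σℤ (suc n) (λ k → f k ℤ.* g (n ∸ k))      ≡⟨ cong (a ℤ.*_) (*ₚ-def f g n) ⟨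
    a ℤ.* (f *ₚ g) n                                ∎

  *ₚ-assoc : ∀ f g h → f *ₚ g *ₚ h ≗ f *ₚ (g *ₚ h)
  *ₚ-assoc f g h zero    = ℤ.*-assoc (f 0) (g 0) (h 0)
  *ₚ-assoc f g h (suc n) = begin
    (f *ₚ g *ₚ h) (suc n)
      ≡⟨ *ₚ-suc (f *ₚ g) h n ⟩
    f 0 ℤ.* g 0 ℤ.* h (suc n) ℤ.+ (((f *ₚ g) ∘ suc) *ₚ h) n
      ≡⟨ cong (λ x → f 0 ℤ.* g 0 ℤ.* h (suc n) ℤ.+ x) (trans
           (*ₚ-cong {((f *ₚ g) ∘ suc)} {g = h} (*ₚ-suc f g) (λ _ → refl) n)
           (trans (*ₚ-distribʳ h (λ k → f 0 ℤ.* g (suc k)) ((f ∘ suc) *ₚ g) n)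
             (cong₂ ℤ._+_ (*ₚ-scaleˡ (f 0) (g ∘ suc) h n) (*ₚ-assoc (f ∘ suc) g h n)))) ⟩
    f 0 ℤ.* g 0 ℤ.* h (suc n) ℤ.+ (f 0 ℤ.* ((g ∘ suc) *ₚ h) n ℤ.+ ((f ∘ suc) *ₚ (g *ₚ h)) n)
      ≡⟨ solve 5 (λ a b c d e → a :* b :* c :+ (a :* d :+ e) := a :* (b :* c :+ d) :+ e) refl
           (f 0) (g 0) (h (suc n)) (((g ∘ suc) *ₚ h) n) (((f ∘ suc) *ₚ (g *ₚ h)) n) ⟩
    f 0 ℤ.* (g 0 ℤ.* h (suc n) ℤ.+ ((g ∘ suc) *ₚ h) n) ℤ.+ ((f ∘ suc) *ₚ (g *ₚ h)) n
      ≡⟨ cong (λ x → f 0 ℤ.* x ℤ.+ ((f ∘ suc) *ₚ (g *ₚ h)) n) (*ₚ-suc g h n) ⟨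
    f 0 ℤ.* (g *ₚ h) (suc n) ℤ.+ ((f ∘ suc) *ₚ (g *ₚ h)) n
      ≡⟨ *ₚ-suc f (g *ₚ h) n ⟨
    (f *ₚ (g *ₚ h)) (suc n) ∎

  *ₚ-zeroˡ : ∀ f → 0ₚ *ₚ f ≗ 0ₚ
  *ₚ-zeroˡ f n = trans (*ₚ-def 0ₚ f n) (Σ-zero (suc n) λ k → refl)

  *ₚ-identityˡ : ∀ f → 1ₚ *ₚ f ≗ f
  *ₚ-identityˡ f zero    = ℤ.*-identityˡ (f 0)
  *ₚ-identityˡ f (suc n) = begin
    (1ₚ *ₚ f) (suc n)                       ≡⟨ *ₚ-suc 1ₚ f n ⟩
    + 1 ℤ.* f (suc n) ℤ.+ (0ₚ *ₚ f) n       ≡⟨ cong₂ ℤ._+_ (ℤ.*-identityˡ (f (suc n))) (*ₚ-zeroˡ f n) ⟩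
    f (suc n) ℤ.+ + 0                       ≡⟨ ℤ.+-identityʳ _ ⟩
    f (suc n)                               ∎

  VanishesBelow : ℕ → PS → Set
  VanishesBelow k f = ∀ n → n < k → f n ≡ + 0

  ^ₚ-vanishesBelow : ∀ {f} → f 0 ≡ + 0 → ∀ k → VanishesBelow k (f ^ₚ k)
  ^ₚ-vanishesBelow {f} f0≡0 (suc k) zero _ = trans (cong ((f ^ₚ k) 0 ℤ.*_) f0≡0) (ℤ.*-zeroʳ ((f ^ₚ k) 0))
  ^ₚ-vanishesBelow {f} f0≡0 (suc k) (suc n) (s≤s n<k) = begin
    (f ^ₚ k *ₚ f) (suc n)                               ≡⟨ *ₚ-comm (f ^ₚ k) f (suc n) ⟩
    (f *ₚ f ^ₚ k) (suc n)                               ≡⟨ *ₚ-suc f (f ^ₚ k) n ⟩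
    f 0 ℤ.* (f ^ₚ k) (suc n) ℤ.+ ((f ∘ suc) *ₚ f ^ₚ k) n
      ≡⟨ cong₂ ℤ._+_ (cong (ℤ._* (f ^ₚ k) (suc n)) f0≡0) (trans
           (*ₚ-cong< {f ∘ suc} {g′ = 0ₚ} n (λ _ _ → refl) (λ i i≤n → ^ₚ-vanishesBelow {f} f0≡0 k i (ℕ.≤-<-trans i≤n n<k)))
           (trans (*ₚ-comm (f ∘ suc) 0ₚ n) (*ₚ-zeroˡ (f ∘ suc) n))) ⟩
    + 0                                                 ∎

  poch-constant : ∀ {a} p → a 0 ≡ + 0 → ∀ k → poch a p k 0 ≡ + 1
  poch-constant p a0≡0 zero    = refl
  poch-constant p a0≡0 (suc k) = cong₂ ℤ._*_ (poch-constant p a0≡0 k) (cong (λ x → + 1 ℤ.- x ℤ.* (p ^ₚ k) 0) a0≡0)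

  module Truncated (M : ℕ) where

    infix 4 _≈_

    record _≈_ (f g : PS) : Set where
      constructor agree
      field coefficients : ∀ n → n < M → f n ≡ g n
    open _≈_ public

    ≗⇒≈ : ∀ {f g} → f ≗ g → f ≈ g
    ≗⇒≈ f≗g = agree λ n _ → f≗g n

    -- The quotient by q^M keeps all series as elements and only coarsens equality, so coefficients
    -- below M can be read off directly.
    truncatedRing : CommutativeRing _ _
    truncatedRing = record
      { Carrier = PS ; _≈_ = _≈_ ; _+_ = _+ₚ_ ; _*_ = _*ₚ_ ; -_ = negₚ ; 0# = 0ₚ ; 1# = 1ₚ
      ; isCommutativeRing = record
        { isRing = record
          { +-isAbelianGroup = record
            { isGroup = record
              { isMonoid = record
                { isSemigroup = record
                  { isMagma = record
                    { isEquivalence = record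
                      { refl  = ≗⇒≈ λ _ → refl
                      ; sym   = λ f≈g → agree λ n n<M → sym (coefficients f≈g n n<M)
                      ; trans = λ f≈g g≈h → agree λ n n<M → trans (coefficients f≈g n n<M) (coefficients g≈h n n<M)
                      }
                    ; ∙-cong = λ f≈ g≈ → agree λ n n<M → cong₂ ℤ._+_ (coefficients f≈ n n<M) (coefficients g≈ n n<M)
                    }
                  ; assoc = λ f g h → ≗⇒≈ λ n → ℤ.+-assoc (f n) (g n) (h n)
                  }
                ; identity = (λ f → ≗⇒≈ λ n → ℤ.+-identityˡ (f n)) , (λ f → ≗⇒≈ λ n → ℤ.+-identityʳ (f n))
                }
              ; inverse = (λ f → ≗⇒≈ λ n → ℤ.+-inverseˡ (f n)) , (λ f → ≗⇒≈ λ n → ℤ.+-inverseʳ (f n))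
              ; ⁻¹-cong = λ f≈g → agree λ n n<M → cong ℤ.-_ (coefficients f≈g n n<M)
              }
            ; comm = λ f g → ≗⇒≈ λ n → ℤ.+-comm (f n) (g n)
            }
          ; *-cong = λ f≈ g≈ → agree λ n n<M → *ₚ-cong< n
              (λ k k≤n → coefficients f≈ k (ℕ.≤-<-trans k≤n n<M)) (λ k k≤n → coefficients g≈ k (ℕ.≤-<-trans k≤n n<M))
          ; *-assoc = λ f g h → ≗⇒≈ (*ₚ-assoc f g h)
          ; *-identity = (λ f → ≗⇒≈ (*ₚ-identityˡ f)) , (λ f → ≗⇒≈ λ n → trans (*ₚ-comm f 1ₚ n) (*ₚ-identityˡ f n))
          ; distrib = (λ h f g → ≗⇒≈ λ n → trans (*ₚ-comm h (f +ₚ g) n) (trans (*ₚ-distribʳ h f g n)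
                         (cong₂ ℤ._+_ (*ₚ-comm f h n) (*ₚ-comm g h n))))
                    , (λ h f g → ≗⇒≈ (*ₚ-distribʳ h f g))
          }
        ; *-comm = λ f g → ≗⇒≈ (*ₚ-comm f g)
        }
      }

    module PS = CommutativeRing truncatedRing
    module QS = QSeries truncatedRing
    open QS using (_^_; ^-congˡ)
    module Sums = FiniteSums truncatedRing

    ^ₚ≈^ : ∀ f k → f ^ₚ k ≈ f ^ k
    ^ₚ≈^ f zero    = PS.refl
    ^ₚ≈^ f (suc k) = PS.trans (PS.*-congʳ {f} {f ^ₚ k} {f ^ k} (^ₚ≈^ f k)) (PS.*-comm (f ^ k) f)

    poch≈ : ∀ {a a′ p p′} → a ≈ a′ → p ≈ p′ → ∀ k → poch a p k ≈ QS.poch a′ p′ k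
    poch≈ a≈ p≈ zero = PS.refl
    poch≈ {a} {a′} {p} {p′} a≈ p≈ (suc k) =
      PS.*-cong {poch a p k} {QS.poch a′ p′ k} {1ₚ -ₚ a *ₚ p ^ₚ k} {1ₚ -ₚ a′ *ₚ p′ ^ k} (poch≈ a≈ p≈ k)
        (PS.+-congˡ {1ₚ} (PS.-‿cong {a *ₚ p ^ₚ k} {a′ *ₚ p′ ^ k} (PS.*-cong a≈ (PS.trans (^ₚ≈^ p k) (^-congˡ k p≈)))))

    Σ-coefficient : ∀ n f N → Sums.Σ< n f N ≡ Σℤ n (λ k → f k N)
    Σ-coefficient zero    f N = refl
    Σ-coefficient (suc n) f N = cong (ℤ._+ f n N) (Σ-coefficient n f N)

    Σₚ≈Σ< : ∀ n f → Σₚ n f ≈ Sums.Σ< (suc n) f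
    Σₚ≈Σ< n f = ≗⇒≈ λ N → trans (sumℤ≡Σℤ n _) (sym (Σ-coefficient (suc n) f N))

    inv-inverse : ∀ {f} → f 0 ≡ + 1 → inv f *ₚ f ≈ 1ₚ
    inv-inverse {f} f0≡1 = QS.geometric-inverse {f} {inv f} M
      (PS.trans {g ^ M} {g ^ₚ M} {0ₚ} (PS.sym (^ₚ≈^ g M)) (agree (^ₚ-vanishesBelow g0≡0 M)))
      (PS.trans {inv f} {Sums.Σ< M (g ^ₚ_)} {Sums.Σ< M (g ^_)} inv≈ (Sums.Σ-cong M (^ₚ≈^ g)))
      where
      g : PS
      g = 1ₚ -ₚ f

      g0≡0 : g 0 ≡ + 0
      g0≡0 = cong (λ x → + 1 ℤ.- x) f0≡1

      -- The definition of `inv` cuts the geometric series at a place depending on the coefficient.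
      -- The k-th power of g has order at least k, so for coefficients below M the cut may be moved
      -- to M.
      inv≈ : inv f ≈ Sums.Σ< M (g ^ₚ_)
      inv≈ = agree λ n n<M → begin
        inv f n
          ≡⟨ sumℤ≡Σℤ n _ ⟩
        Σℤ (suc n) (λ k → (g ^ₚ k) n)
          ≡⟨ Σ-extend (suc n) (M ∸ suc n) (λ k n<k → ^ₚ-vanishesBelow g0≡0 k n n<k) ⟨
        Σℤ (suc n ℕ.+ (M ∸ suc n)) (λ k → (g ^ₚ k) n)
          ≡⟨ cong (λ m → Σℤ m (λ k → (g ^ₚ k) n)) (ℕ.m+[n∸m]≡n n<M) ⟩
        Σℤ M (λ k → (g ^ₚ k) n)
          ≡⟨ Σ-coefficient M (g ^ₚ_) n ⟨
        Sums.Σ< M (g ^ₚ_) n ∎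

    inv-poch : ∀ {a a′ p p′} → a ≈ a′ → p ≈ p′ → a 0 ≡ + 0 → ∀ k → inv (poch a p k) *ₚ QS.poch a′ p′ k ≈ 1ₚ
    inv-poch {a} {a′} {p} {p′} a≈ p≈ a0≡0 k = PS.trans
      (PS.*-congˡ {inv (poch a p k)} {QS.poch a′ p′ k} {poch a p k} (PS.sym (poch≈ a≈ p≈ k)))
      (inv-inverse {poch a p k} (poch-constant {a} p a0≡0 k))

open import Data.Nat using (_+_; _*_)
open import Data.Product using (_×_)

-- Transfer to the coefficient of q^N.

module Coefficient (N : ℕ) where

  open ≡ using (refl; sym; trans)
  open PowerSeries
  open FiniteSums ℤ.+-*-commutativeRing using () renaming (Σ-cong to ℤΣ-cong)

  M : ℕ
  -- The least modulus that still shows the coefficient of q^N; the ranges k < M are then exactly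
  -- the ranges k ≤ N in `Σ∞` and `Σ∞₂`.
  M = suc N

  open Truncated M
  open QS using (_^_; ^-congˡ; ^-congʳ; ^-assocʳ)
  open RightSide truncatedRing using (summand)
  open DoubleSum truncatedRing using (E; T)
  open FiniteSums truncatedRing using (Σ<; Σ-cong)
  module RR = RogersRamanujan truncatedRing

  private
    -- The reciprocals in the two sides, together with `v`, the merged denominator of base q^5 that
    -- serves the triple product and the q-binomial theorem.
    i j u v w : ℕ → PS
    i k = inv (poch q q k)
    j k = inv (poch (q ^ₚ 2) (q ^ₚ 2) k)
    u k = inv (poch (q ^ₚ 5) (q ^ₚ 10) k)
    v k = inv (poch (q ^ₚ 5) (q ^ₚ 5) k)
    w k = inv (poch (q ^ₚ 10) (q ^ₚ 10) k)

    q^M≈0 : q ^ M ≈ 0ₚ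
    q^M≈0 = PS.trans {q ^ M} {q ^ₚ M} {0ₚ} (PS.sym {q ^ₚ M} {q ^ M} (^ₚ≈^ q M)) (agree (^ₚ-vanishesBelow {q} refl M))

    i-inv : ∀ k → i k *ₚ QS.poch q q k ≈ 1ₚ
    i-inv = inv-poch {q} {q} {q} {q} PS.refl PS.refl refl

    j-inv : ∀ k → j k *ₚ QS.poch (q ^ 2) (q ^ 2) k ≈ 1ₚ
    j-inv = inv-poch {q ^ₚ 2} {q ^ 2} {q ^ₚ 2} {q ^ 2} (^ₚ≈^ q 2) (^ₚ≈^ q 2) refl

    u-inv : ∀ k → u k *ₚ QS.poch (q ^ 5) (q ^ 10) k ≈ 1ₚ
    u-inv = inv-poch {q ^ₚ 5} {q ^ 5} {q ^ₚ 10} {q ^ 10} (^ₚ≈^ q 5) (^ₚ≈^ q 10) refl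

    v-inv : ∀ k → v k *ₚ QS.poch (q ^ 5) (q ^ 5) k ≈ 1ₚ
    v-inv = inv-poch {q ^ₚ 5} {q ^ 5} {q ^ₚ 5} {q ^ 5} (^ₚ≈^ q 5) (^ₚ≈^ q 5) refl

    w-inv : ∀ k → w k *ₚ QS.poch (q ^ 10) (q ^ 10) k ≈ 1ₚ
    w-inv = inv-poch {q ^ₚ 10} {q ^ 10} {q ^ₚ 10} {q ^ 10} (^ₚ≈^ q 10) (^ₚ≈^ q 10) refl

    Σ∞-coefficient : ∀ f → Σ∞ f N ≡ Σ< M f N
    Σ∞-coefficient f = trans (sumℤ≡Σℤ N (λ k → f k N)) (sym (Σ-coefficient M f N))

    Σ∞₂-coefficient : ∀ f → Σ∞₂ f N ≡ Σ< M (λ m → Σ< M (f m)) N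
    Σ∞₂-coefficient f = trans (sumℤ≡Σℤ N _) (trans
      (ℤΣ-cong M (λ m → Σ∞-coefficient (f m)))
      (sym (Σ-coefficient M (λ m → Σ< M (f m)) N)))

    module I = RR.Identities q M q^M≈0 (s≤s z≤n) i j u v w i-inv j-inv u-inv v-inv w-inv

    left-side : ∀ k (e e′ : ℕ → ℕ → ℕ) → (∀ m n → e m n ≡ E k m n) → (∀ m n → e′ m n ≡ 2 * m + 4 * n + suc k) →
      Σ∞₂ (λ m n → q ^ₚ e m n *ₚ (1ₚ +ₚ q ^ₚ e′ m n) *ₚ i m *ₚ j n) N ≡ I.double-sum k N
    left-side k e e′ e≡ e′≡ = trans (Σ∞₂-coefficient (λ m n → q ^ₚ e m n *ₚ (1ₚ +ₚ q ^ₚ e′ m n) *ₚ i m *ₚ j n)) (coefficients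
      (Σ-cong M λ m → Σ-cong M λ n → RR.double-summand-cong
        (q ^ₚ e m n) (q ^ E k m n) (q ^ₚ e′ m n) (q ^ (2 * m + 4 * n + suc k)) (i m) (j n)
        (power (e≡ m n)) (power (e′≡ m n))) N ℕ.≤-refl)
      where
      power : ∀ {a b} → a ≡ b → q ^ₚ a ≈ q ^ b
      power {a} refl = ^ₚ≈^ q a

    inner : (c d g : PS) → ℕ → ℕ → ℕ → PS
    inner c d g k ε i = qbin (q ^ₚ 10) k i *ₚ poch (negₚ c) (q ^ₚ 10) (i + ε) *ₚ poch (negₚ d) (q ^ₚ 10) i
      *ₚ inv (poch (q ^ₚ 5) (q ^ₚ 10) (i + ε)) *ₚ g ^ₚ (k ∸ i)

    inner≈ : ∀ c c′ d d′ g g′ → c ≈ c′ → d ≈ d′ → g ≈ g′ → ∀ k ε i →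
      inner c d g k ε i ≈ summand c′ d′ g′ (q ^ 10) u w k ε i
    inner≈ c c′ d d′ g g′ c≈ d≈ g≈ k ε i = RR.inner-summand-cong
      (poch (q ^ₚ 10) (q ^ₚ 10) k) (QS.poch (q ^ 10) (q ^ 10) k) (w i) (w (k ∸ i))
      (poch (negₚ c) (q ^ₚ 10) (i + ε)) (QS.poch (negₚ c′) (q ^ 10) (i + ε))
      (poch (negₚ d) (q ^ₚ 10) i) (QS.poch (negₚ d′) (q ^ 10) i)
      (u (i + ε)) (g ^ₚ (k ∸ i)) (g′ ^ (k ∸ i))
      (poch≈ {q ^ₚ 10} {q ^ 10} {q ^ₚ 10} {q ^ 10} (^ₚ≈^ q 10) (^ₚ≈^ q 10) k)
      (poch≈ {negₚ c} {negₚ c′} {q ^ₚ 10} {q ^ 10} (PS.-‿cong {c} {c′} c≈) (^ₚ≈^ q 10) (i + ε))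
      (poch≈ {negₚ d} {negₚ d′} {q ^ₚ 10} {q ^ 10} (PS.-‿cong {d} {d′} d≈) (^ₚ≈^ q 10) i)
      (PS.trans {g ^ₚ (k ∸ i)} {g ^ (k ∸ i)} {g′ ^ (k ∸ i)} (^ₚ≈^ g (k ∸ i)) (^-congˡ (k ∸ i) g≈))

    right-side : ∀ (z z′ : ℕ → PS) c c′ d d′ g g′ → (∀ j → z j ≈ z′ j) → c ≈ c′ → d ≈ d′ → g ≈ g′ →
      Σ∞ (λ j → z j *ₚ w ⌊ j /2⌋ *ₚ Σₚ ⌊ j /2⌋ (inner c d g ⌊ j /2⌋ (⌈ j /2⌉ ∸ ⌊ j /2⌋))) N
      ≡ Σ< M (λ j → z′ j *ₚ w ⌊ j /2⌋ *ₚ Σ< (suc ⌊ j /2⌋) (summand c′ d′ g′ (q ^ 10) u w ⌊ j /2⌋ (⌈ j /2⌉ ∸ ⌊ j /2⌋))) N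
    right-side z z′ c c′ d d′ g g′ z≈ c≈ d≈ g≈ = trans
      (Σ∞-coefficient (λ j → z j *ₚ w ⌊ j /2⌋ *ₚ Σₚ ⌊ j /2⌋ (inner c d g ⌊ j /2⌋ (⌈ j /2⌉ ∸ ⌊ j /2⌋))))
      (coefficients (Σ-cong M λ j → RR.outer-summand-cong (z j) (z′ j) (w ⌊ j /2⌋)
        (Σₚ ⌊ j /2⌋ (inner c d g ⌊ j /2⌋ (⌈ j /2⌉ ∸ ⌊ j /2⌋)))
        (Σ< (suc ⌊ j /2⌋) (summand c′ d′ g′ (q ^ 10) u w ⌊ j /2⌋ (⌈ j /2⌉ ∸ ⌊ j /2⌋)))
        (z≈ j)
        (sums ⌊ j /2⌋ (⌈ j /2⌉ ∸ ⌊ j /2⌋))) N ℕ.≤-refl)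
      where
      sums : ∀ k ε → Σₚ k (inner c d g k ε) ≈ Σ< (suc k) (summand c′ d′ g′ (q ^ 10) u w k ε)
      sums k ε = PS.trans {Σₚ k (inner c d g k ε)} {Σ< (suc k) (inner c d g k ε)} {Σ< (suc k) (summand c′ d′ g′ (q ^ 10) u w k ε)}
        (Σₚ≈Σ< k (inner c d g k ε)) (Σ-cong (suc k) (inner≈ c c′ d d′ g g′ c≈ d≈ g≈ k ε))

    q²ʲ : ∀ j → q ^ₚ (2 * j) ≈ (q ^ 2) ^ j
    q²ʲ j = PS.trans {q ^ₚ (2 * j)} {q ^ (2 * j)} {(q ^ 2) ^ j} (^ₚ≈^ q (2 * j)) (PS.sym {(q ^ 2) ^ j} {q ^ (2 * j)} (^-assocʳ q 2 j))

  first : Σ∞₂ (λ m n → q ^ₚ (T m + 4 * m * n + 4 * n * n) *ₚ (1ₚ +ₚ q ^ₚ (2 * m + 4 * n + 1)) *ₚ i m *ₚ j n) N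
    ≡ Σ∞ (λ j → q ^ₚ j *ₚ w ⌊ j /2⌋ *ₚ Σₚ ⌊ j /2⌋ (inner (q ^ₚ 3) (q ^ₚ 8) (q ^ₚ 6) ⌊ j /2⌋ (⌈ j /2⌉ ∸ ⌊ j /2⌋))) N
  first = trans (left-side 0 (λ m n → T m + 4 * m * n + 4 * n * n) (λ m n → 2 * m + 4 * n + 1)
      (λ m n → sym (ℕ.+-identityʳ (T m + 4 * m * n + 4 * n * n))) (λ m n → refl))
    (trans (coefficients I.first-identity N ℕ.≤-refl)
      (sym (right-side (q ^ₚ_) (q ^_) (q ^ₚ 3) (q ^ 3) (q ^ₚ 8) (q ^ 8) (q ^ₚ 6) (q ^ 6)
        (^ₚ≈^ q) (^ₚ≈^ q 3) (^ₚ≈^ q 8) (^ₚ≈^ q 6))))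

  second : Σ∞₂ (λ m n → q ^ₚ (T m + 4 * m * n + 4 * n * n + m + 2 * n) *ₚ (1ₚ +ₚ q ^ₚ (2 * m + 4 * n + 2)) *ₚ i m *ₚ j n) N
    ≡ Σ∞ (λ j → q ^ₚ (2 * j) *ₚ w ⌊ j /2⌋ *ₚ Σₚ ⌊ j /2⌋ (inner q (q ^ₚ 6) (q ^ₚ 2) ⌊ j /2⌋ (⌈ j /2⌉ ∸ ⌊ j /2⌋))) N
  second = trans (left-side 1 (λ m n → T m + 4 * m * n + 4 * n * n + m + 2 * n) (λ m n → 2 * m + 4 * n + 2)
      (λ m n → lem (T m) m n) (λ m n → refl))
    (trans (coefficients I.second-identity N ℕ.≤-refl)
      (sym (right-side (λ j → q ^ₚ (2 * j)) ((q ^ 2) ^_) q q (q ^ₚ 6) (q ^ 6) (q ^ₚ 2) (q ^ 2)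
        q²ʲ (PS.refl {q}) (^ₚ≈^ q 6) (^ₚ≈^ q 2))))
    where
    lem : ∀ t m n → t + 4 * m * n + 4 * n * n + m + 2 * n ≡ t + 4 * m * n + 4 * n * n + 1 * (m + 2 * n)
    lem = solve-∀

theorem6p1 :
      ((N : ℕ) →
        Σ∞₂ (λ m n →
            q ^ₚ (⌊ m * (3 * m + 1) /2⌋ + 4 * m * n + 4 * n * n)
              *ₚ (1ₚ +ₚ q ^ₚ (2 * m + 4 * n + 1))
              *ₚ inv (poch q q m) *ₚ inv (poch (q ^ₚ 2) (q ^ₚ 2) n)) N
        ≡
        Σ∞ (λ j →
            q ^ₚ j *ₚ inv (poch (q ^ₚ 10) (q ^ₚ 10) ⌊ j /2⌋)
              *ₚ Σₚ ⌊ j /2⌋ (λ i →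
                   qbin (q ^ₚ 10) ⌊ j /2⌋ i
                     *ₚ poch (negₚ (q ^ₚ 3)) (q ^ₚ 10) (i + (⌈ j /2⌉ ∸ ⌊ j /2⌋))
                     *ₚ poch (negₚ (q ^ₚ 8)) (q ^ₚ 10) i
                     *ₚ inv (poch (q ^ₚ 5) (q ^ₚ 10) (i + (⌈ j /2⌉ ∸ ⌊ j /2⌋)))
                     *ₚ (q ^ₚ 6) ^ₚ (⌊ j /2⌋ ∸ i))) N)
      ×
      ((N : ℕ) →
        Σ∞₂ (λ m n →
            q ^ₚ (⌊ m * (3 * m + 1) /2⌋ + 4 * m * n + 4 * n * n + m + 2 * n)
              *ₚ (1ₚ +ₚ q ^ₚ (2 * m + 4 * n + 2))
              *ₚ inv (poch q q m) *ₚ inv (poch (q ^ₚ 2) (q ^ₚ 2) n)) N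
        ≡
        Σ∞ (λ j →
            q ^ₚ (2 * j) *ₚ inv (poch (q ^ₚ 10) (q ^ₚ 10) ⌊ j /2⌋)
              *ₚ Σₚ ⌊ j /2⌋ (λ i →
                   qbin (q ^ₚ 10) ⌊ j /2⌋ i
                     *ₚ poch (negₚ q) (q ^ₚ 10) (i + (⌈ j /2⌉ ∸ ⌊ j /2⌋))
                     *ₚ poch (negₚ (q ^ₚ 6)) (q ^ₚ 10) i
                     *ₚ inv (poch (q ^ₚ 5) (q ^ₚ 10) (i + (⌈ j /2⌉ ∸ ⌊ j /2⌋)))
                     *ₚ (q ^ₚ 2) ^ₚ (⌊ j /2⌋ ∸ i))) N)
theorem6p1 = Coefficient.first , Coefficient.second
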